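{- Let $\Sigma=(G,\sigma)$ be a signed graph with $m$ edges and let $k$ be a positive integer with $$k>\frac{m-1}{\ln(1+\sqrt{2})}.$$ Then $P_l^0(\Sigma,k)=P(\Sigma,k)$ if $k$ is even, and $P_l^1(\Sigma,k)=P(\Sigma,k)$ if $k$ is odd. Further, a list-assignment $L$ attaining this equality (i.e., a $0$-free $k$-assignment when $k$ is even, resp. a $0$-included $k$-assignment when $k$ is odd, with $P(\Sigma,L)=P(\Sigma,k)$) satisfies $L(v)=\sigma(e)L(u)$ for each edge $e=uv$. In particular, if $\Sigma$ is unbalanced, then such an $L$ satisfies $L(v)=-L(v)$ for each vertex $v$ in any unbalanced component of $\Sigma$.
   Context: A signed graph $\Sigma=(G,\sigma)$ is a finite graph $G$ with a sign function $\sigma:E(G)\to\{ -1,1\}$; an edge $e$ is negative if $\sigma(e)=-1$ and positive otherwise. A cycle is unbalanced if it has an odd number of negative edges and balanced otherwise; a signed graph (or a component) is unbalanced if it contains an unbalanced cycle and balanced otherwise. For a positive integer $k$, let $M_k=\{0,\pm1,\ldots,\pm t\}$ if $k=2t+1$ and $M_k=\{\pm1,\ldots,\pm t\}$ if $k=2t$. A proper $k$-coloring of $\Sigma$ is a map $c:V(\Sigma)\to M_k$ with $c(u)\neq\sigma(e)c(v)$ for every edge $e=uv$; $P(\Sigma,k)$ denotes the number of proper $k$-colorings. A list-assignment $L$ assigns to each vertex $v$ a nonempty set $L(v)\subseteq\mathbb{Z}$; it is a $k$-assignment if $|L(v)|=k$ for all $v$. An $L$-coloring is a map $c$ with $c(v)\in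 L(v)$ for all $v$ and $c(u)\neq\sigma(e)c(v)$ for every edge $e=uv$; $P(\Sigma,L)$ is the number of $L$-colorings. For $S\subseteq\mathbb{Z}$ and $s\in\{\pm1\}$, $sS=\{sa:a\in S\}$. $L$ is $0$-free if $0\notin L(v)$ for all $v$, and $0$-included if $0\in L(v)$ for all $v$. Define $P_l^0(\Sigma,k)=\min\{P(\Sigma,L): L \text{ a } 0\text{ -free } k\text{ -assignment}\}$ and $P_l^1(\Sigma,k)=\min\{P(\Sigma,L): L\text{ a }0\text{ -included }k\text{ -assignment}\}$. -}

module Defs where

open import Data.Nat as ℕ using (ℕ; zero; suc; _∸_; _^_; ⌊_/2⌋)
open import Data.Integer as ℤ using (ℤ; +_; -[1+_]; +[1+_]; -_)
open import Data.Fin using (Fin)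
open import Data.Bool using (Bool; true; false; not; if_then_else_)
open import Data.List using (List; []; _∷_; [_]; map; concatMap; length)
open import Data.Nat.ListAction using (sum)
open import Data.Bool.ListAction using (all)
open import Data.List.Membership.Propositional using (_∈_; _∉_)
open import Data.List.Relation.Unary.All using (All)
open import Data.List.Relation.Unary.AllPairs using (AllPairs)
open import Data.List.Relation.Unary.Unique.Propositional using (Unique)
open import Data.Vec using (Vec; lookup) renaming ([] to []ᵥ; _∷_ to _∷ᵥ_)
open import Data.Product using (Σ; ∃; ∃-syntax; _×_; _,_)
open import Data.Sum using (_⊎_)
open import Relation.Binary.PropositionalEquality using (_≡_; _≢_)
open import Relation.Nullary using (¬_; does)

data Sign : Set where
  pos neg : Sign

⟦_⟧ : Sign → ℤ
⟦ pos ⟧ = + 1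
⟦ neg ⟧ = -[1+ 0 ]

Edge : ℕ → Set
Edge n = Fin n × Fin n × Sign

SamePair : ∀ {n} → Edge n → Edge n → Set
SamePair (u , v , _) (u' , v' , _) = (u ≡ u' × v ≡ v') ⊎ (u ≡ v' × v ≡ u')

NotLoop : ∀ {n} → Edge n → Set
NotLoop (u , v , _) = u ≢ v

record SignedGraph : Set where
  field
    n        : ℕ
    edges    : List (Edge n)
    loopless : All NotLoop edges
    simple   : AllPairs (λ e f → ¬ SamePair e f) edges

open SignedGraph public

numEdges : SignedGraph → ℕ
numEdges S = length (edges S)

Adj : (S : SignedGraph) → Fin (n S) → Fin (n S) → Sign → Set
Adj S u v s = ((u , v , s) ∈ edges S) ⊎ ((v , u , s) ∈ edges S)

data Walk (S : SignedGraph) : Fin (n S) → Fin (n S) → List (Fin (n S)) → List Sign → Set where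
  here : ∀ {v} → Walk S v v [ v ] []
  step : ∀ {u w v vs ss s} → Adj S u w s → Walk S w v vs ss → Walk S u v (u ∷ vs) (s ∷ ss)

negCount : List Sign → ℕ
negCount []          = 0
negCount (pos ∷ ss)  = negCount ss
negCount (neg ∷ ss)  = suc (negCount ss)

Even Odd : ℕ → Set
Even k = ∃[ t ] k ≡ 2 ℕ.* t
Odd  k = ∃[ t ] k ≡ suc (2 ℕ.* t)

UnbalancedCycle : (S : SignedGraph) → List (Fin (n S)) → Set
UnbalancedCycle S vs =
  Σ (Fin (n S)) λ u → Σ (Fin (n S)) λ w → Σ (List Sign) λ ss → Σ Sign λ s →
    Walk S u w vs ss × Unique vs × 3 ℕ.≤ length vs × Adj S w u s ×
    Odd (negCount (s ∷ ss))

Unbalanced : SignedGraph → Set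
Unbalanced S = ∃[ vs ] UnbalancedCycle S vs

Connected : (S : SignedGraph) → Fin (n S) → Fin (n S) → Set
Connected S u v = ∃[ vs ] ∃[ ss ] Walk S u v vs ss

InUnbalancedComponent : (S : SignedGraph) → Fin (n S) → Set
InUnbalancedComponent S v =
  ∃[ vs ] (UnbalancedCycle S vs × ∃[ w ] (w ∈ vs × Connected S v w))

-- M_{2t+1} = {0, ±1, …, ±t},  M_{2t} = {±1, …, ±t}
M : ℕ → List ℤ
M zero          = []
M (suc zero)    = + 0 ∷ []
M (suc (suc k)) = +[1+ ⌊ k /2⌋ ] ∷ -[1+ ⌊ k /2⌋ ] ∷ M k

ListAssignment : SignedGraph → Set
ListAssignment S = Vec (List ℤ) (n S)

choices : ∀ {m} → Vec (List ℤ) m → List (Vec ℤ m)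
choices []ᵥ       = []ᵥ ∷ []
choices (l ∷ᵥ ls) = concatMap (λ a → map (a ∷ᵥ_) (choices ls)) l

properᵇ : (S : SignedGraph) → Vec ℤ (n S) → Bool
properᵇ S c = all (λ { (u , v , s) → not (does (lookup c u ℤ.≟ ⟦ s ⟧ ℤ.* lookup c v)) }) (edges S)

countᵇ : ∀ {A : Set} → (A → Bool) → List A → ℕ
countᵇ p xs = sum (map (λ x → if p x then 1 else 0) xs)

PL : (S : SignedGraph) → ListAssignment S → ℕ
PL S L = countᵇ (properᵇ S) (choices L)

constAssign : ∀ m → List ℤ → Vec (List ℤ) m
constAssign zero    l = []ᵥ
constAssign (suc m) l = l ∷ᵥ constAssign m l

P : SignedGraph → ℕ → ℕ
P S k = PL S (constAssign (n S) (M k))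

KAssignment : (S : SignedGraph) → ℕ → ListAssignment S → Set
KAssignment S k L = ∀ v → Unique (lookup L v) × length (lookup L v) ≡ k

ZeroFree : (S : SignedGraph) → ListAssignment S → Set
ZeroFree S L = ∀ v → + 0 ∉ lookup L v

ZeroIncluded : (S : SignedGraph) → ListAssignment S → Set
ZeroIncluded S L = ∀ v → + 0 ∈ lookup L v

IsMinOver : (S : SignedGraph) → (ListAssignment S → Set) → ℕ → Set
IsMinOver S Class value =
  (∃[ L ] (Class L × PL S L ≡ value)) × (∀ L → Class L → value ℕ.≤ PL S L)

SetEq : List ℤ → List ℤ → Set
SetEq A B = ∀ a → (a ∈ A → a ∈ B) × (a ∈ B → a ∈ A)

scale : Sign → List ℤ → List ℤ
scale s A = map (⟦ s ⟧ ℤ.*_) A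

EdgeCompatible : (S : SignedGraph) → ListAssignment S → Set
EdgeCompatible S L =
  All (λ { (u , v , s) → SetEq (lookup L v) (scale s (lookup L u)) }) (edges S)

-- The bound k > (m-1)/ln(1+√2), expressed without real numbers.
-- (1+√2)^k = pellA k + pellB k · √2.

pellA pellB : ℕ → ℕ
pellA zero    = 1
pellA (suc k) = pellA k ℕ.+ 2 ℕ.* pellB k
pellB zero    = 0
pellB (suc k) = pellA k ℕ.+ pellB k

-- p < q · (1+√2)^k   (all quantities natural, decided exactly)
LtSqrt2Pow : ℕ → ℕ → ℕ → Set
LtSqrt2Pow k p q =
  (p ℕ.< q ℕ.* pellA k) ⊎
  (q ℕ.* pellA k ℕ.≤ p × (p ∸ q ℕ.* pellA k) ^ 2 ℕ.< 2 ℕ.* (q ℕ.* pellB k) ^ 2)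

-- e^x < (1+√2)^k, using that (N/(N-x))^N decreases strictly to e^x
-- as N → ∞ (N > x): e^x < y iff ∃ N > x, (N/(N-x))^N < y.
ExpLtSqrt2Pow : ℕ → ℕ → Set
ExpLtSqrt2Pow x k = ∃[ N ] (x ℕ.< N × LtSqrt2Pow k (N ^ N) ((N ∸ x) ^ N))

-- k > (m-1)/ln(1+√2)  ⟺  (1+√2)^k > e^(m-1)   (for k ≥ 1; when m = 0
-- the original condition holds for all k ≥ 1, as does e^0 < (1+√2)^k).
KBound : ℕ → ℕ → Set
KBound m k = ExpLtSqrt2Pow (m ∸ 1) k

{-# OPTIONS --safe #-}
-- Write P(Σ, L) by inclusion–exclusion, adding violated edges one at a time in
-- a fixed order: if e is implied by the edges S already violated, no colouring
-- violating S is proper on e, so only independent sets S survive (and only the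
-- balanced ones if 0 is not a colour). The same S survive for L and for the
-- constant assignment M_k, and a surviving S is violated by at most k^(n-|S|)
-- colourings, with equality for M_k, and by at least
-- k^(n-|S|) - k^(n-|S|-1) ∑_{e ∈ S} α(e), where α(uv) = k - |L(v) ∩ σ L(u)|.
-- Singletons contribute exactly k^(n-2) α(e) to P(Σ, L) - P(Σ, k), and only the
-- S of even size can contribute negatively. So P(Σ, L) - P(Σ, k) is at least
-- ∑ α(e) times k^(n-2) - ∑_{j odd} C(m-1, j) k^(n-2-j), which is positive as soon
-- as ((1 + 1/k)^(m-1) - (1 - 1/k)^(m-1)) / 2 < 1. The bound on k gives this, the
-- left side being at most sinh ((m-1)/k) and sinh (ln (1 + √2)) = 1.
module Submission where

open import Defs
open import Algebra.Bundles using (CommutativeMonoid)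
open import Data.Bool using (Bool; true; false; not; if_then_else_)
open import Data.Bool.ListAction using (all)
open import Data.Fin using (Fin; zero; suc)
import Data.Fin.Properties as Fin
open import Data.Integer using (-_)
open import Data.Integer as ℤ using (ℤ; 0ℤ)
import Data.Integer.Properties as ℤ
open import Data.List using (List; []; _∷_; [_]; map; concatMap; length; filter; _++_)
open import Data.List.Properties
  using (map-++; map-∘; length-map; length-++; length-filter; filter-accept; filter-reject; filter-all; filter-complete)
open import Data.List.Membership.Propositional using (_∈_; _∉_)
open import Data.List.Membership.Propositional.Properties
  using (∈-filter⁺; ∈-filter⁻; ∈-map⁺; ∈-map⁻; ∈-∃++; ∈-++⁻; ∈-++⁺ˡ; ∈-++⁺ʳ)
open import Data.List.Membership.DecPropositional ℤ._≟_ using (_∈?_)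
open import Data.List.Relation.Unary.Any using (here; there)
open import Data.List.Relation.Unary.All using (All; []; _∷_)
import Data.List.Relation.Unary.All as All
import Data.List.Relation.Unary.All.Properties as All
open import Data.List.Relation.Unary.AllPairs using (AllPairs; []; _∷_)
open import Data.List.Relation.Unary.Unique.Propositional using (Unique)
import Data.List.Relation.Unary.Unique.Propositional.Properties as Unique
open import Data.Nat
  using (ℕ; zero; suc; _+_; _*_; _∸_; _^_; _≤_; _<_; z≤n; s≤s; ⌊_/2⌋; NonZero; >-nonZero; >-nonZero⁻¹; ≢-nonZero)
open import Data.Nat.ListAction using (sum)
open import Data.Nat.ListAction.Properties using (sum-++)
open import Data.Nat.Properties
open import Data.Nat.Tactic.RingSolver using (solve-∀)
open import Data.Product using (∃; _×_; _,_; proj₁; proj₂)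
open import Data.Sum using (_⊎_; inj₁; inj₂; [_,_]′)
open import Data.Vec as Vec using (Vec; []; _∷_; lookup; _[_]≔_; replicate)
open import Data.Vec.Properties using (lookup∘updateAt; lookup∘updateAt′; lookup-replicate)
open import Function using (_∘_; _⇔_; mk⇔; Equivalence)
open import Relation.Binary.PropositionalEquality hiding ([_])
open import Relation.Nullary using (¬_; Dec; yes; no; does; contradiction)
open import Relation.Nullary.Decidable using (¬?)
open import Relation.Unary using (Decidable)

-- The condition on k

-- No real function occurs below. `KBound` supplies one `N > r`, where `r = m - 1`, with
-- `(N / (N - r))^N < (1 + √2)^k`, and sinh is replaced as follows. Put `T = k N` and let `j² = 1`.
-- Coefficientwise, `(1 + j/k)^r` is at most `(1 + j/T)^(N r)`, which is at most `(1 - r j/T)^(-N)`.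
-- With `t = T^N`, `p = (T - r)^N`, `q = (T + r)^N`, the odd part of the last expression is
-- `(t/p - t/q) / 2`. Since `p q ≤ t²`, it is at most `(t/p - p/t) / 2`, and this is below 1 because
-- `t/p < 1 + √2`. In the counting half, a set of violated edges is stored as an identification of
-- vertices. A violated edge may also force the colour 0, by closing an unbalanced cycle; a
-- permanent slot of colour 0 makes this one more identification. The recursion subtracts the count
-- of the contracted graph, which reverses inequalities, so upper and lower bounds have to be proved
-- together.

^-distribʳ-* : ∀ a b n → (a * b) ^ n ≡ a ^ n * b ^ n
^-distribʳ-* a b zero    = refl
^-distribʳ-* a b (suc n) rewrite ^-distribʳ-* a b n = lem a b (a ^ n) (b ^ n)
  where
  lem : ∀ a b x y → a * b * (x * y) ≡ a * x * (b * y)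
  lem = solve-∀

^-swap : ∀ a m n → (a ^ m) ^ n ≡ (a ^ n) ^ m
^-swap a m n = begin
  (a ^ m) ^ n  ≡⟨ ^-*-assoc a m n ⟩
  a ^ (m * n)  ≡⟨ cong (a ^_) (*-comm m n) ⟩
  a ^ (n * m)  ≡⟨ ^-*-assoc a n m ⟨
  (a ^ n) ^ m  ∎
  where open ≡-Reasoning

square-cancel-≤ : ∀ {a b} → a * a ≤ b * b → a ≤ b
square-cancel-≤ {a} {b} p with a ≤? b
... | yes q = q
... | no  q = contradiction p (<⇒≱ (*-mono-< (≰⇒> q) (≰⇒> q)))

-- p ≥ a + b √2
record AtLeast (p a b : ℕ) : Set where
  constructor mkAtLeast
  field
    excess : ℕ
    splits : p ≡ a + excess
    large  : 2 * (b * b) ≤ excess * excess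

-- Multiplication by `1 + √2`, which is also the recursion of `pellA` and `pellB`. The excesses
-- satisfy `f ≥ p √2` and `e ≥ B √2`, so `f e` covers the rational term `2 p B` (`twice`); the
-- surplus `z` joins the new excess.
atLeast-step : ∀ {t p X A B} → AtLeast t p p → AtLeast X A B →
               AtLeast (t * X) (p * (A + 2 * B)) (p * (A + B))
atLeast-step {p = p} {A = A} {B} (mkAtLeast f refl f²) (mkAtLeast e refl e²) =
  mkAtLeast (p * e + f * A + z) eq sq
  where
  twice : 2 * (p * B) ≤ f * e
  twice = square-cancel-≤ (begin
    2 * (p * B) * (2 * (p * B))        ≡⟨ lem₁ p B ⟩
    2 * (p * p) * (2 * (B * B))        ≤⟨ *-mono-≤ f² e² ⟩
    f * f * (e * e)                    ≡⟨ lem₂ f e ⟩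
    f * e * (f * e)                    ∎)
    where
    open ≤-Reasoning
    lem₁ : ∀ p B → 2 * (p * B) * (2 * (p * B)) ≡ 2 * (p * p) * (2 * (B * B))
    lem₁ = solve-∀
    lem₂ : ∀ f e → f * f * (e * e) ≡ f * e * (f * e)
    lem₂ = solve-∀
  z = f * e ∸ 2 * (p * B)
  z-eq : 2 * (p * B) + z ≡ f * e
  z-eq = m+[n∸m]≡n twice
  eq : (p + f) * (A + e) ≡ p * (A + 2 * B) + (p * e + f * A + z)
  eq = begin
    (p + f) * (A + e)                                ≡⟨ lem₁ p f A e ⟩
    p * A + p * e + f * A + f * e                    ≡⟨ cong (p * A + p * e + f * A +_) (sym z-eq) ⟩
    p * A + p * e + f * A + (2 * (p * B) + z)        ≡⟨ lem₂ p f A e B z ⟩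
    p * (A + 2 * B) + (p * e + f * A + z)            ∎
    where
    open ≡-Reasoning
    lem₁ : ∀ p f A e → (p + f) * (A + e) ≡ p * A + p * e + f * A + f * e
    lem₁ = solve-∀
    lem₂ : ∀ p f A e B z → p * A + p * e + f * A + (2 * (p * B) + z) ≡ p * (A + 2 * B) + (p * e + f * A + z)
    lem₂ = solve-∀
  sq : 2 * (p * (A + B) * (p * (A + B))) ≤ (p * e + f * A + z) * (p * e + f * A + z)
  sq = begin
    2 * (p * (A + B) * (p * (A + B)))
      ≡⟨ lem₁ p A B ⟩
    p * p * (2 * (B * B)) + 2 * (p * A * (2 * (p * B))) + 2 * (p * p) * (A * A)
      ≤⟨ +-mono-≤ (+-mono-≤ (*-monoʳ-≤ (p * p) e²) (*-monoʳ-≤ 2 (*-monoʳ-≤ (p * A) twice))) (*-monoˡ-≤ (A * A) f²) ⟩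
    p * p * (e * e) + 2 * (p * A * (f * e)) + f * f * (A * A)
      ≡⟨ lem₂ p A e f ⟩
    (p * e + f * A) * (p * e + f * A)
      ≤⟨ *-mono-≤ (m≤m+n (p * e + f * A) z) (m≤m+n (p * e + f * A) z) ⟩
    (p * e + f * A + z) * (p * e + f * A + z) ∎
    where
    open ≤-Reasoning
    lem₁ : ∀ p A B → 2 * (p * (A + B) * (p * (A + B)))
                   ≡ p * p * (2 * (B * B)) + 2 * (p * A * (2 * (p * B))) + 2 * (p * p) * (A * A)
    lem₁ = solve-∀
    lem₂ : ∀ p A e f → p * p * (e * e) + 2 * (p * A * (f * e)) + f * f * (A * A)
                     ≡ (p * e + f * A) * (p * e + f * A)
    lem₂ = solve-∀

atLeast-^ : ∀ {t p} k → AtLeast t p p → AtLeast (t ^ k) (p ^ k * pellA k) (p ^ k * pellB k)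
atLeast-^ zero _ = mkAtLeast 0 refl z≤n
atLeast-^ {t} {p} (suc k) h =
  subst₂ (AtLeast (t ^ suc k)) (lem₁ p (p ^ k) (pellA k) (pellB k)) (lem₂ p (p ^ k) (pellA k) (pellB k))
    (atLeast-step h (atLeast-^ k h))
  where
  lem₁ : ∀ p q A B → p * (q * A + 2 * (q * B)) ≡ p * q * (A + 2 * B)
  lem₁ = solve-∀
  lem₂ : ∀ p q A B → p * (q * A + q * B) ≡ p * q * (A + B)
  lem₂ = solve-∀

-- Division by `c`, rounding the coefficient `P / c` down to `H`. Rounding only enlarges the excess,
-- which is therefore at least `e / c`.
atLeast-cancel : ∀ c {x P H A B} .{{_ : NonZero c}} → c * H ≤ P →
                 AtLeast (c * x) (P * A) (P * B) → AtLeast x (H * A) (H * B)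
atLeast-cancel c {x} {P} {H} {A} {B} cH≤P (mkAtLeast e eq e²) = mkAtLeast (x ∸ H * A) (sym x-eq) sq
  where
  open ≤-Reasoning
  scaled : c * (H * A) + e ≤ c * x
  scaled = begin
    c * (H * A) + e  ≡⟨ cong (_+ e) (*-assoc c H A) ⟨
    c * H * A + e    ≤⟨ +-monoˡ-≤ e (*-monoˡ-≤ A cH≤P) ⟩
    P * A + e        ≡⟨ eq ⟨
    c * x            ∎
  HA≤x : H * A ≤ x
  HA≤x = *-cancelˡ-≤ c (≤-trans (m≤m+n _ e) scaled)
  f = x ∸ H * A
  x-eq : H * A + f ≡ x
  x-eq = m+[n∸m]≡n HA≤x
  e≤cf : e ≤ c * f
  e≤cf = +-cancelˡ-≤ (c * (H * A)) _ _ (begin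
    c * (H * A) + e      ≤⟨ scaled ⟩
    c * x                ≡⟨ cong (c *_) (sym x-eq) ⟩
    c * (H * A + f)      ≡⟨ *-distribˡ-+ c (H * A) f ⟩
    c * (H * A) + c * f  ∎)
  lem₁ : ∀ c H B → c * c * (2 * (H * B * (H * B))) ≡ 2 * (c * H * B * (c * H * B))
  lem₁ = solve-∀
  lem₂ : ∀ c f → c * f * (c * f) ≡ c * c * (f * f)
  lem₂ = solve-∀
  instance
    _ : NonZero (c * c)
    _ = m*n≢0 c c
  sq : 2 * (H * B * (H * B)) ≤ f * f
  sq = *-cancelˡ-≤ (c * c) (begin
    c * c * (2 * (H * B * (H * B)))   ≡⟨ lem₁ c H B ⟩
    2 * (c * H * B * (c * H * B))     ≤⟨ *-monoʳ-≤ 2 (*-mono-≤ (*-monoˡ-≤ B cH≤P) (*-monoˡ-≤ B cH≤P)) ⟩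
    2 * (P * B * (P * B))             ≤⟨ e² ⟩
    e * e                             ≤⟨ *-mono-≤ e≤cf e≤cf ⟩
    c * f * (c * f)                   ≡⟨ lem₂ c f ⟩
    c * c * (f * f)                   ∎)

atLeast⇒≮ : ∀ k {p q} → AtLeast p (q * pellA k) (q * pellB k) → ¬ LtSqrt2Pow k p q
atLeast⇒≮ k (mkAtLeast e refl _) (inj₁ lt) = <⇒≱ lt (m≤m+n _ e)
atLeast⇒≮ k {p} {q} (mkAtLeast e refl e²) (inj₂ (_ , lt)) = <⇒≱ lt (begin
  2 * (q * pellB k) ^ 2                          ≡⟨ cong (2 *_) (lem (q * pellB k)) ⟩
  2 * (q * pellB k * (q * pellB k))              ≤⟨ e² ⟩
  e * e                                          ≡⟨ lem e ⟨
  e ^ 2                                          ≡⟨ cong (_^ 2) (m+n∸m≡n (q * pellA k) e) ⟨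
  (q * pellA k + e ∸ q * pellA k) ^ 2            ∎)
  where
  open ≤-Reasoning
  lem : ∀ x → x ^ 2 ≡ x * x
  lem x = cong (x *_) (*-identityʳ x)

-- Bernoulli's inequality `(1 - x)^(j + 1) ≥ 1 - (j + 1) x` at `x = r / (r + g)`, with denominators
-- and subtraction cleared.
bernoulli : ∀ r g j → (r + g) ^ suc j ≤ g ^ suc j + suc j * r * (r + g) ^ j
bernoulli r g zero = ≤-reflexive (lem r g)
  where
  lem : ∀ r g → (r + g) * 1 ≡ g * 1 + 1 * r * 1
  lem = solve-∀
bernoulli r g (suc j) = begin
  (r + g) * (r + g) ^ suc j                                      ≤⟨ *-monoʳ-≤ (r + g) (bernoulli r g j) ⟩
  (r + g) * (g ^ suc j + suc j * r * (r + g) ^ j)                ≡⟨ lem₁ r g (g ^ suc j) ((r + g) ^ j) j ⟩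
  g * g ^ suc j + (r * g ^ suc j + suc j * r * (r + g) ^ suc j)
    ≤⟨ +-monoʳ-≤ (g * g ^ suc j) (+-monoˡ-≤ _ (*-monoʳ-≤ r (^-monoˡ-≤ (suc j) (m≤n+m g r)))) ⟩
  g * g ^ suc j + (r * (r + g) ^ suc j + suc j * r * (r + g) ^ suc j)
    ≡⟨ cong (g * g ^ suc j +_) (lem₂ r j ((r + g) ^ suc j)) ⟩
  g * g ^ suc j + suc (suc j) * r * (r + g) ^ suc j              ∎
  where
  open ≤-Reasoning
  lem₁ : ∀ r g x y j → (r + g) * (x + (1 + j) * r * y) ≡ g * x + (r * x + (1 + j) * r * ((r + g) * y))
  lem₁ = solve-∀
  lem₂ : ∀ r j x → r * x + (1 + j) * r * x ≡ (2 + j) * r * x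
  lem₂ = solve-∀

-- With t = T^N and p = (T - r)^N, where T = k N, this says t / p < 1 + √2:
-- by Bernoulli, (T / (T - r))^k ≤ N / (N - r).
root-bound : ∀ j r h g → let k = suc j; N = r + h; T = r + g in T ≡ k * N → 0 < N →
             LtSqrt2Pow k (N ^ N) (h ^ N) →
             T ^ N * T ^ N < 2 * (T ^ N * g ^ N) + g ^ N * g ^ N
root-bound j r h g T≡ N>0 lt with (r + g) ^ (r + h) * (r + g) ^ (r + h) <? 2 * ((r + g) ^ (r + h) * g ^ (r + h)) + g ^ (r + h) * g ^ (r + h)
... | yes q = q
... | no  q = contradiction lt (atLeast⇒≮ k {N ^ N} {h ^ N} (atLeast-cancel c {P = p ^ k} {A = pellA k} {B = pellB k} cH≤
    (subst (λ x → AtLeast x (p ^ k * pellA k) (p ^ k * pellB k)) t^k (atLeast-^ k base))))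
  where
  k = suc j
  N = r + h
  T = r + g
  t = T ^ N
  p = g ^ N
  -- The factor by which `t ^ k` exceeds `N ^ N`, as `T = k N`.
  c = (T ^ j * k) ^ N
  instance
    nzN : NonZero N
    nzN = >-nonZero N>0
    nzT : NonZero T
    nzT = subst NonZero (sym T≡) (m*n≢0 k N)
    nzTj : NonZero (T ^ j * k)
    nzTj = m*n≢0 (T ^ j) k {{m^n≢0 T j}}
    nzc : NonZero c
    nzc = m^n≢0 (T ^ j * k) N
  p≤t : p ≤ t
  p≤t = ^-monoˡ-≤ N (m≤n+m g r)
  -- The negated goal says `(t - p)² ≥ 2 p²`, that is, `t ≥ p (1 + √2)`.
  base : AtLeast t p p
  base = mkAtLeast (t ∸ p) (sym tp) (+-cancelʳ-≤ (2 * (t * p) + p * p) _ _ (begin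
      2 * (p * p) + (2 * (t * p) + p * p)       ≤⟨ +-monoʳ-≤ _ (≮⇒≥ q) ⟩
      2 * (p * p) + t * t                       ≡⟨ cong (λ x → 2 * (p * p) + x * x) (sym tp) ⟩
      2 * (p * p) + (p + f) * (p + f)           ≡⟨ lem p f ⟩
      f * f + (2 * ((p + f) * p) + p * p)       ≡⟨ cong (λ x → f * f + (2 * (x * p) + p * p)) tp ⟩
      f * f + (2 * (t * p) + p * p)             ∎))
    where
    open ≤-Reasoning
    f = t ∸ p
    tp : p + f ≡ t
    tp = m+[n∸m]≡n p≤t
    lem : ∀ p f → 2 * (p * p) + (p + f) * (p + f) ≡ f * f + (2 * ((p + f) * p) + p * p)
    lem = solve-∀
  t^k : t ^ k ≡ c * N ^ N
  t^k = begin
    (T ^ N) ^ k              ≡⟨ ^-swap T N k ⟩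
    (T ^ k) ^ N              ≡⟨ cong (_^ N) (trans (cong (_* T ^ j) T≡) (lem k N (T ^ j))) ⟩
    (T ^ j * k * N) ^ N      ≡⟨ ^-distribʳ-* (T ^ j * k) N N ⟩
    c * N ^ N                ∎
    where
    open ≡-Reasoning
    lem : ∀ k N x → k * N * x ≡ x * k * N
    lem = solve-∀
  -- Bernoulli in the form `(1 - r/T)^k ≥ 1 - r/N = h/N`.
  one : T ^ j * k * h ≤ g ^ k
  one = +-cancelʳ-≤ (k * r * T ^ j) _ _ (begin
    T ^ j * k * h + k * r * T ^ j   ≡⟨ lem (T ^ j) k h r ⟩
    k * (r + h) * T ^ j             ≡⟨ cong (_* T ^ j) T≡ ⟨
    T * T ^ j                       ≤⟨ bernoulli r g j ⟩
    g ^ k + k * r * T ^ j           ∎)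
    where
    open ≤-Reasoning
    lem : ∀ x k h r → x * k * h + k * r * x ≡ k * (r + h) * x
    lem = solve-∀
  cH≤ : c * h ^ N ≤ p ^ k
  cH≤ = begin
    c * h ^ N              ≡⟨ ^-distribʳ-* (T ^ j * k) h N ⟨
    (T ^ j * k * h) ^ N    ≤⟨ ^-monoˡ-≤ N one ⟩
    (g ^ k) ^ N            ≡⟨ ^-swap g k N ⟩
    (g ^ N) ^ k            ∎
    where open ≤-Reasoning

-- The odd part of `(k + j)^r`

-- The pair (c , s) stands for c + s j with j² = 1.
_⊗_ : ℕ × ℕ → ℕ × ℕ → ℕ × ℕ
(a , b) ⊗ (c , d) = a * c + b * d , a * d + b * c

⊗-assoc : ∀ x y z → (x ⊗ y) ⊗ z ≡ x ⊗ (y ⊗ z)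
⊗-assoc (a , b) (c , d) (e , f) = cong₂ _,_ (lem₁ a b c d e f) (lem₁ a b c d f e)
  where
  lem₁ : ∀ a b c d e f → (a * c + b * d) * e + (a * d + b * c) * f ≡ a * (c * e + d * f) + b * (c * f + d * e)
  lem₁ = solve-∀

⊗-comm : ∀ x y → x ⊗ y ≡ y ⊗ x
⊗-comm (a , b) (c , d) = cong₂ _,_ (lem₁ a b c d) (lem₂ a b c d)
  where
  lem₁ : ∀ a b c d → a * c + b * d ≡ c * a + d * b
  lem₁ = solve-∀
  lem₂ : ∀ a b c d → a * d + b * c ≡ c * b + d * a
  lem₂ = solve-∀

⊗-identityˡ : ∀ x → (1 , 0) ⊗ x ≡ x
⊗-identityˡ (a , b) = cong₂ _,_ (lem₁ a b) (lem₁ b a)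
  where
  lem₁ : ∀ a b → 1 * a + 0 * b ≡ a
  lem₁ = solve-∀

⊗-commutativeMonoid : CommutativeMonoid _ _
⊗-commutativeMonoid = record
  { Carrier = ℕ × ℕ ; _≈_ = _≡_ ; _∙_ = _⊗_ ; ε = 1 , 0
  ; isCommutativeMonoid = record
    { isMonoid = record
      { isSemigroup = record
        { isMagma = record { isEquivalence = isEquivalence ; ∙-cong = cong₂ _⊗_ }
        ; assoc = ⊗-assoc }
      ; identity = ⊗-identityˡ , λ x → trans (⊗-comm x (1 , 0)) (⊗-identityˡ x) }
    ; comm = ⊗-comm } }

open import Algebra.Properties.CommutativeMonoid.Mult ⊗-commutativeMonoid
  using (×-assocˡ; ×-distrib-+) renaming (_×_ to pow)

infix 4 _≼_
_≼_ : ℕ × ℕ → ℕ × ℕ → Set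
(a , b) ≼ (c , d) = a ≤ c × b ≤ d

⊗-mono : ∀ x y z w → x ≼ y → z ≼ w → (x ⊗ z) ≼ (y ⊗ w)
⊗-mono _ _ _ _ (a , b) (c , d) = +-mono-≤ (*-mono-≤ a c) (*-mono-≤ b d) , +-mono-≤ (*-mono-≤ a d) (*-mono-≤ b c)

pow-mono : ∀ x y n → x ≼ y → pow n x ≼ pow n y
pow-mono _ _ zero    _ = ≤-refl , ≤-refl
pow-mono x y (suc n) h = ⊗-mono x y (pow n x) (pow n y) h (pow-mono x y n h)

pow-scalar : ∀ a n → pow n (a , 0) ≡ (a ^ n , 0)
pow-scalar a zero    = refl
pow-scalar a (suc n) rewrite pow-scalar a n = cong₂ _,_ (+-identityʳ _) (trans (+-identityʳ _) (*-zeroʳ a))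

pow-swap : ∀ x m n → pow m (pow n x) ≡ pow n (pow m x)
pow-swap x m n = trans (×-assocˡ x m n) (trans (cong (λ i → pow i x) (*-comm m n)) (sym (×-assocˡ x n m)))

-- Evaluation at `j = -1`, which is multiplicative; `pow-sum` is evaluation at `j = 1`.
pow-difference : ∀ r g N → let (c , s) = pow N (r + g , r) in c ≡ s + g ^ N
pow-difference r g zero = refl
pow-difference r g (suc N) with pow N (r + g , r) | pow-difference r g N
... | c , s | refl = lem r g s (g ^ N)
  where
  lem : ∀ r g s x → (r + g) * (s + x) + r * s ≡ (r + g) * s + r * (s + x) + g * x
  lem = solve-∀

pow-sum : ∀ a b N → let (c , s) = pow N (a , b) in c + s ≡ (a + b) ^ N
pow-sum a b zero = refl
pow-sum a b (suc N) = trans (lem a b (proj₁ (pow N (a , b))) (proj₂ (pow N (a , b)))) (cong ((a + b) *_) (pow-sum a b N))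
  where
  lem : ∀ a b c s → a * c + b * s + (a * s + b * c) ≡ (a + b) * (c + s)
  lem = solve-∀

pow-≥ : ∀ T b r → T ^ r ≤ proj₁ (pow r (T , b))
pow-≥ T b zero    = ≤-refl
pow-≥ T b (suc r) = ≤-trans (*-monoʳ-≤ T (pow-≥ T b r)) (m≤m+n _ _)

-- 1 + N j / T ≼ (1 + j / T) ^ N, both sides multiplied by T ^ N.
pow-bernoulli : ∀ T N → (T ^ suc N , suc N * T ^ N) ≼ pow (suc N) (T , 1)
pow-bernoulli T zero = ≤-reflexive (lem₁ T) , ≤-reflexive (lem₂ T)
  where
  lem₁ : ∀ T → T * 1 ≡ T * 1 + 1 * 0
  lem₁ = solve-∀
  lem₂ : ∀ T → 1 ≡ T * 0 + 1 * 1
  lem₂ = solve-∀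
pow-bernoulli T (suc N) = pow-≥ T 1 (suc (suc N)) , (begin
  T ^ suc N + suc N * (T * T ^ N)                    ≡⟨ lem (T * T ^ N) T (suc N) (T ^ N) ⟩
  T * (suc N * T ^ N) + 1 * (T * T ^ N)              ≤⟨ +-mono-≤ (*-monoʳ-≤ T (proj₂ (pow-bernoulli T N))) (*-monoʳ-≤ 1 (pow-≥ T 1 (suc N))) ⟩
  proj₂ (pow (suc (suc N)) (T , 1))                  ∎)
  where
  open ≤-Reasoning
  lem : ∀ y T n x → y + n * (T * x) ≡ T * (n * x) + 1 * y
  lem = solve-∀

-- (1 + j / T) ^ r ≼ (1 - (r / T) j)⁻¹, both sides multiplied by T ^ r (T² - r²).
pow-geometric : ∀ T r → let (c , s) = pow r (T , 1) in
                T * T * c ≤ T * T * T ^ r + r * r * c × T * T * s ≤ r * (T * T ^ r) + r * r * s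
pow-geometric T zero = m≤m+n _ _ , ≤-reflexive (*-zeroʳ (T * T))
pow-geometric T (suc r) with pow r (T , 1) | pow-geometric T r | pow-≥ T 1 r
... | c , s | hc , hs | T^r≤c = goal₁ , goal₂
  where
  open ≤-Reasoning
  x = T ^ r
  goal₁ : T * T * (T * c + 1 * s) ≤ T * T * (T * x) + suc r * suc r * (T * c + 1 * s)
  goal₁ = begin
    T * T * (T * c + 1 * s)                                     ≡⟨ lem₁ T c s ⟩
    T * (T * T * c) + T * T * s                                 ≤⟨ +-mono-≤ (*-monoʳ-≤ T hc) hs ⟩
    T * (T * T * x + r * r * c) + (r * (T * x) + r * r * s)     ≤⟨ +-monoʳ-≤ (T * (T * T * x + r * r * c)) (+-monoˡ-≤ (r * r * s) (*-monoʳ-≤ r (*-monoʳ-≤ T T^r≤c))) ⟩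
    T * (T * T * x + r * r * c) + (r * (T * c) + r * r * s)     ≤⟨ m≤m+n _ ((r + 1) * (T * c) + (2 * r + 1) * s) ⟩
    _                                                           ≡⟨ lem₂ T c s r x ⟩
    T * T * (T * x) + suc r * suc r * (T * c + 1 * s)           ∎
    where
    lem₁ : ∀ T c s → T * T * (T * c + 1 * s) ≡ T * (T * T * c) + T * T * s
    lem₁ = solve-∀
    lem₂ : ∀ T c s r x → T * (T * T * x + r * r * c) + (r * (T * c) + r * r * s) + ((r + 1) * (T * c) + (2 * r + 1) * s)
         ≡ T * T * (T * x) + (1 + r) * (1 + r) * (T * c + 1 * s)
    lem₂ = solve-∀
  goal₂ : T * T * (T * s + 1 * c) ≤ suc r * (T * (T * x)) + suc r * suc r * (T * s + 1 * c)
  goal₂ = begin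
    T * T * (T * s + 1 * c)                                     ≡⟨ lem₁ T c s ⟩
    T * (T * T * s) + T * T * c                                 ≤⟨ +-mono-≤ (*-monoʳ-≤ T hs) hc ⟩
    T * (r * (T * x) + r * r * s) + (T * T * x + r * r * c)     ≤⟨ m≤m+n _ ((2 * r + 1) * (T * s + c)) ⟩
    _                                                           ≡⟨ lem₂ T c s r x ⟩
    suc r * (T * (T * x)) + suc r * suc r * (T * s + 1 * c)     ∎
    where
    lem₁ : ∀ T c s → T * T * (T * s + 1 * c) ≡ T * (T * T * s) + T * T * c
    lem₁ = solve-∀
    lem₂ : ∀ T c s r x → T * (r * (T * x) + r * r * s) + (T * T * x + r * r * c) + ((2 * r + 1) * (T * s + c))
         ≡ (1 + r) * (T * (T * x)) + (1 + r) * (1 + r) * (T * s + 1 * c)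
    lem₂ = solve-∀

scalar-⊗ : ∀ a c d → (a , 0) ⊗ (c , d) ≡ (a * c , a * d)
scalar-⊗ a c d = cong₂ _,_ (+-identityʳ _) (+-identityʳ _)

-- Since `g (r + T) = T² - r²`, this is `pow-geometric` with its `r²` terms moved to the left; the
-- inverse of `1 - r j/T` appears as `T (T + r j) / (T² - r²)`.
pow-geometric′ : ∀ r g → let T = r + g in
                 ((g * (r + T) , 0) ⊗ pow r (T , 1)) ≼ ((T ^ suc r , 0) ⊗ (T , r))
pow-geometric′ r g with pow r (r + g , 1) | pow-geometric (r + g) r
... | c , s | hc , hs = subst₂ _≼_ (sym (scalar-⊗ (g * (r + T)) c s)) (sym (scalar-⊗ (T ^ suc r) T r)) (goal₁ , goal₂)
  where
  T = r + g
  open ≤-Reasoning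
  lem : ∀ r g c → g * (r + (r + g)) * c + r * r * c ≡ (r + g) * (r + g) * c
  lem = solve-∀
  lem₁ : ∀ T x y → T * T * x + y ≡ T * x * T + y
  lem₁ = solve-∀
  lem₂ : ∀ T r x y → r * (T * x) + y ≡ T * x * r + y
  lem₂ = solve-∀
  goal₁ : g * (r + T) * c ≤ T ^ suc r * T
  goal₁ = +-cancelʳ-≤ (r * r * c) _ _ (begin
    g * (r + T) * c + r * r * c  ≡⟨ lem r g c ⟩
    T * T * c                    ≤⟨ hc ⟩
    T * T * T ^ r + r * r * c    ≡⟨ lem₁ T (T ^ r) (r * r * c) ⟩
    T ^ suc r * T + r * r * c    ∎)
  goal₂ : g * (r + T) * s ≤ T ^ suc r * r
  goal₂ = +-cancelʳ-≤ (r * r * s) _ _ (begin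
    g * (r + T) * s + r * r * s  ≡⟨ lem r g s ⟩
    T * T * s                    ≤⟨ hs ⟩
    r * (T * T ^ r) + r * r * s  ≡⟨ lem₂ T r (T ^ r) (r * r * s) ⟩
    T ^ suc r * r + r * r * s    ∎)

-- Even parts are carried along until the end, because the odd part of a product involves them.
-- `step₂` is the Bernoulli bound raised to the power `r`, `step₃` the geometric bound raised to the
-- power `N`.
odd-part-scaled : ∀ k r g M → let N = suc M; T = r + g in T ≡ k * N →
  (g * (r + T)) ^ N * ((T ^ M * N) ^ r * proj₂ (pow r (k , 1))) ≤ (T ^ suc r) ^ N * proj₂ (pow N (T , r))
odd-part-scaled k r g M T≡ = subst₂ _≤_ (cong proj₂ left) (cong proj₂ right) (proj₂ chain)
  where
  N = suc M
  T = r + g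
  D = g * (r + T)
  x = pow r (k , 1)
  step₁ : ((T ^ M * N , 0) ⊗ (k , 1)) ≼ pow N (T , 1)
  step₁ = subst (_≼ pow N (T , 1)) eq (pow-bernoulli T M)
    where
    lem₁ : ∀ y k n → k * n * y ≡ y * n * k
    lem₁ = solve-∀
    lem₂ : ∀ y n → n * y ≡ y * n * 1
    lem₂ = solve-∀
    eq : (T ^ N , N * T ^ M) ≡ (T ^ M * N , 0) ⊗ (k , 1)
    eq = trans (cong₂ _,_ (trans (cong (_* T ^ M) T≡) (lem₁ (T ^ M) k N)) (lem₂ (T ^ M) N)) (sym (scalar-⊗ (T ^ M * N) k 1))
  step₂ : ((pow r (T ^ M * N , 0)) ⊗ x) ≼ pow N (pow r (T , 1))
  step₂ = subst₂ _≼_ (×-distrib-+ (T ^ M * N , 0) (k , 1) r) (pow-swap (T , 1) r N) (pow-mono ((T ^ M * N , 0) ⊗ (k , 1)) (pow N (T , 1)) r step₁)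
  step₃ : (pow N (D , 0) ⊗ pow N (pow r (T , 1))) ≼ (pow N (T ^ suc r , 0) ⊗ pow N (T , r))
  step₃ = subst₂ _≼_ (×-distrib-+ (D , 0) (pow r (T , 1)) N) (×-distrib-+ (T ^ suc r , 0) (T , r) N)
            (pow-mono ((D , 0) ⊗ pow r (T , 1)) ((T ^ suc r , 0) ⊗ (T , r)) N (pow-geometric′ r g))
  step₄ : (pow N (D , 0) ⊗ (pow r (T ^ M * N , 0) ⊗ x)) ≼ (pow N (D , 0) ⊗ pow N (pow r (T , 1)))
  step₄ = ⊗-mono (pow N (D , 0)) (pow N (D , 0)) (pow r (T ^ M * N , 0) ⊗ x) (pow N (pow r (T , 1))) (≤-refl , ≤-refl) step₂
  chain : (pow N (D , 0) ⊗ (pow r (T ^ M * N , 0) ⊗ x)) ≼ (pow N (T ^ suc r , 0) ⊗ pow N (T , r))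
  chain = ≤-trans (proj₁ step₄) (proj₁ step₃) , ≤-trans (proj₂ step₄) (proj₂ step₃)
  left : pow N (D , 0) ⊗ (pow r (T ^ M * N , 0) ⊗ x) ≡ (D ^ N * ((T ^ M * N) ^ r * proj₁ x) , D ^ N * ((T ^ M * N) ^ r * proj₂ x))
  left = trans (cong₂ (λ u v → u ⊗ (v ⊗ x)) (pow-scalar D N) (pow-scalar (T ^ M * N) r))
        (trans (cong ((D ^ N , 0) ⊗_) (scalar-⊗ ((T ^ M * N) ^ r) (proj₁ x) (proj₂ x)))
               (scalar-⊗ (D ^ N) ((T ^ M * N) ^ r * proj₁ x) ((T ^ M * N) ^ r * proj₂ x)))
  right : pow N (T ^ suc r , 0) ⊗ pow N (T , r) ≡ ((T ^ suc r) ^ N * proj₁ (pow N (T , r)) , (T ^ suc r) ^ N * proj₂ (pow N (T , r)))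
  right = trans (cong (_⊗ pow N (T , r)) (pow-scalar (T ^ suc r) N))
         (scalar-⊗ ((T ^ suc r) ^ N) (proj₁ (pow N (T , r))) (proj₂ (pow N (T , r))))

-- With `q = 2σ + p`, the second hypothesis is `(t/p - t/q) / 2 ≥ 1` and the third `t/q ≥ p/t`.
-- Together they give `t/p - p/t ≥ 2`, against the first.
¬-large-odd-part : ∀ t p σ → t * t < 2 * (t * p) + p * p →
  p * (2 * σ + p) ≤ t * σ → p * (2 * σ + p) ≤ t * t → ¬ 0 < 2 * σ + p
¬-large-odd-part t p σ lt pq≤tσ pq≤t² q>0 = <-irrefl refl (begin-strict
  t * t * q                           <⟨ *-monoˡ-< q {{>-nonZero q>0}} lt ⟩
  (2 * (t * p) + p * p) * q           ≡⟨ lem₁ t p q ⟩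
  2 * t * (p * q) + p * (p * q)       ≤⟨ +-mono-≤ (*-monoʳ-≤ (2 * t) pq≤tσ) (*-monoʳ-≤ p pq≤t²) ⟩
  2 * t * (t * σ) + p * (t * t)       ≡⟨ lem₂ t p σ ⟩
  t * t * q                           ∎)
  where
  open ≤-Reasoning
  q = 2 * σ + p
  lem₁ : ∀ t p q → (2 * (t * p) + p * p) * q ≡ 2 * t * (p * q) + p * (p * q)
  lem₁ = solve-∀
  lem₂ : ∀ t p σ → 2 * t * (t * σ) + p * (t * t) ≡ t * t * (2 * σ + p)
  lem₂ = solve-∀

odd-part-<′ : ∀ r j M h g → let k = suc j; N = suc M in N ≡ r + h → k * N ≡ r + g →
              LtSqrt2Pow k (N ^ N) (h ^ N) → ¬ k ^ r ≤ proj₂ (pow r (k , 1))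
odd-part-<′ r j M h g N≡ kN≡ lt k^r≤s = ¬-large-odd-part t p σ small pq≤tσ pq≤t² q>0
  where
  k = suc j
  N = suc M
  T = r + g
  t = T ^ N
  p = g ^ N
  D = g * (r + T)
  σ = proj₂ (pow N (T , r))
  small : t * t < 2 * (t * p) + p * p
  small = subst (λ n → T ^ n * T ^ n < 2 * (T ^ n * g ^ n) + g ^ n * g ^ n) (sym N≡)
    (root-bound j r h g (trans (sym kN≡) (cong (k *_) N≡)) (subst (0 <_) N≡ (s≤s z≤n))
      (subst (λ n → LtSqrt2Pow k (n ^ n) (h ^ n)) N≡ lt))
  instance
    nzT : NonZero T
    nzT = subst NonZero kN≡ (m*n≢0 k N)
    nzrT : NonZero (r + T)
    nzrT = >-nonZero (≤-trans (>-nonZero⁻¹ T) (m≤n+m T r))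
    nz : NonZero ((T ^ r) ^ N)
    nz = m^n≢0 (T ^ r) N {{m^n≢0 T r}}
  q≡ : (r + T) ^ N ≡ 2 * σ + p
  q≡ = begin
    (r + T) ^ N                        ≡⟨ cong (_^ N) (+-comm r T) ⟩
    (T + r) ^ N                        ≡⟨ pow-sum T r N ⟨
    proj₁ (pow N (T , r)) + σ          ≡⟨ cong (_+ σ) (pow-difference r g N) ⟩
    σ + p + σ                          ≡⟨ lem σ p ⟩
    2 * σ + p                          ∎
    where
    open ≡-Reasoning
    lem : ∀ σ p → σ + p + σ ≡ 2 * σ + p
    lem = solve-∀
  q>0 : 0 < 2 * σ + p
  q>0 = subst (0 <_) q≡ (m^n>0 (r + T) N)
  pq≡ : D ^ N ≡ p * (2 * σ + p)
  pq≡ = trans (^-distribʳ-* g (r + T) N) (cong (p *_) q≡)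
  pq≤t² : p * (2 * σ + p) ≤ t * t
  pq≤t² = begin
    p * (2 * σ + p)  ≡⟨ pq≡ ⟨
    D ^ N            ≤⟨ ^-monoˡ-≤ N (≤-trans (m≤m+n D (r * r)) (≤-reflexive (lem r g))) ⟩
    (T * T) ^ N      ≡⟨ ^-distribʳ-* T T N ⟩
    t * t            ∎
    where
    open ≤-Reasoning
    lem : ∀ r g → g * (r + (r + g)) + r * r ≡ (r + g) * (r + g)
    lem = solve-∀
  pq≤tσ : p * (2 * σ + p) ≤ t * σ
  pq≤tσ = *-cancelʳ-≤ _ _ ((T ^ r) ^ N) (begin
    p * (2 * σ + p) * (T ^ r) ^ N              ≡⟨ cong₂ _*_ (sym pq≡) (T^rN) ⟩
    D ^ N * ((T ^ M * N) ^ r * k ^ r)          ≤⟨ *-monoʳ-≤ (D ^ N) (*-monoʳ-≤ ((T ^ M * N) ^ r) k^r≤s) ⟩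
    D ^ N * ((T ^ M * N) ^ r * proj₂ (pow r (k , 1)))  ≤⟨ odd-part-scaled k r g M (sym kN≡) ⟩
    (T * T ^ r) ^ N * σ                        ≡⟨ cong (_* σ) (^-distribʳ-* T (T ^ r) N) ⟩
    t * (T ^ r) ^ N * σ                        ≡⟨ lem t ((T ^ r) ^ N) σ ⟩
    t * σ * (T ^ r) ^ N                        ∎)
    where
    open ≤-Reasoning
    lem : ∀ t x σ → t * x * σ ≡ t * σ * x
    lem = solve-∀
    lem′ : ∀ k n x → k * n * x ≡ x * n * k
    lem′ = solve-∀
    T^rN : (T ^ r) ^ N ≡ (T ^ M * N) ^ r * k ^ r
    T^rN = trans (^-swap T r N) (trans (cong (_^ r) (trans (cong (_* T ^ M) (sym kN≡)) (lem′ k N (T ^ M))))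
                 (^-distribʳ-* (T ^ M * N) k r))

odd-part-< : ∀ r k → 0 < k → ExpLtSqrt2Pow r k → proj₂ (pow r (k , 1)) < k ^ r
odd-part-< r (suc j) _ (suc M , r<N , lt) = ≰⇒>
  (odd-part-<′ r j M (suc M ∸ r) (suc j * suc M ∸ r)
    (sym (m+[n∸m]≡n (<⇒≤ r<N)))
    (sym (m+[n∸m]≡n (≤-trans (<⇒≤ r<N) (m≤m+n _ _)))) lt)

-- Sums over colourings

when unless : ∀ {A : Set} → Dec A → ℕ → ℕ
when (yes _) c = c
when (no  _) c = 0
unless (yes _) c = 0
unless (no  _) c = c

unless+when : ∀ {A : Set} (d : Dec A) c → unless d c + when d c ≡ c
unless+when (yes _) c = refl
unless+when (no  _) c = +-identityʳ c

when-⇔ : ∀ {A B : Set} (d : Dec A) (e : Dec B) {c c′} → A ⇔ B → (B → c ≡ c′) → when d c ≡ when e c′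
when-⇔ (yes a) (yes b) _ h = h b
when-⇔ (yes a) (no ¬b) f _ = contradiction (Equivalence.to f a) ¬b
when-⇔ (no ¬a) (yes b) f _ = contradiction (Equivalence.from f b) ¬a
when-⇔ (no ¬a) (no ¬b) _ _ = refl

sumL : List ℤ → (ℤ → ℕ) → ℕ
sumL l f = sum (map f l)

sumL-cong : ∀ l {f g} → (∀ a → a ∈ l → f a ≡ g a) → sumL l f ≡ sumL l g
sumL-cong []      _ = refl
sumL-cong (a ∷ l) h = cong₂ _+_ (h a (here refl)) (sumL-cong l (λ b → h b ∘ there))

sumL-0 : ∀ l → sumL l (λ _ → 0) ≡ 0
sumL-0 []      = refl
sumL-0 (_ ∷ l) = sumL-0 l

+-interchange : ∀ a b c d → a + b + (c + d) ≡ a + c + (b + d)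
+-interchange = solve-∀

sumL-+ : ∀ l f g → sumL l (λ a → f a + g a) ≡ sumL l f + sumL l g
sumL-+ []      f g = refl
sumL-+ (a ∷ l) f g = trans (cong (f a + g a +_) (sumL-+ l f g)) (+-interchange (f a) (g a) _ _)

sumL-const : ∀ l c → sumL l (λ _ → c) ≡ length l * c
sumL-const []      c = refl
sumL-const (_ ∷ l) c = cong (c +_) (sumL-const l c)

sumL-∉ : ∀ {b l} c → b ∉ l → sumL l (λ a → when (a ℤ.≟ b) c) ≡ 0
sumL-∉ {b} {l} c b∉l = trans (sumL-cong l vanish) (sumL-0 l)
  where
  vanish : ∀ a → a ∈ l → when (a ℤ.≟ b) c ≡ 0
  vanish a a∈l with a ℤ.≟ b
  ... | yes refl = contradiction a∈l b∉l
  ... | no  _    = refl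

sumL-∈ : ∀ {b l} c → Unique l → b ∈ l → sumL l (λ a → when (a ℤ.≟ b) c) ≡ c
sumL-∈ {b} {a ∷ l} c (a≢ ∷ u) b∈ with a ℤ.≟ b
... | yes refl = trans (cong (c +_) (sumL-∉ c (All.All¬⇒¬Any a≢))) (+-identityʳ c)
sumL-∈ {b} {a ∷ l} c (a≢ ∷ u) (here refl)  | no a≢b = contradiction refl a≢b
sumL-∈ {b} {a ∷ l} c (a≢ ∷ u) (there b∈l) | no a≢b = sumL-∈ c u b∈l

sumL-≟ : ∀ b l c → Unique l → sumL l (λ a → when (a ℤ.≟ b) c) ≡ when (b ∈? l) c
sumL-≟ b l c u with b ∈? l
... | yes b∈l = sumL-∈ c u b∈l
... | no  b∉l = sumL-∉ c b∉l

sumV : ∀ {m} → Vec (List ℤ) m → (Vec ℤ m → ℕ) → ℕ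
sumV []       f = f []
sumV (l ∷ ls) f = sumL l (λ a → sumV ls (f ∘ (a ∷_)))

sum-choices : ∀ {m} (ls : Vec (List ℤ) m) f → sum (map f (choices ls)) ≡ sumV ls f
sum-choices []       f = +-identityʳ (f [])
sum-choices (l ∷ ls) f = outer l
  where
  outer : ∀ l → sum (map f (concatMap (λ a → map (a ∷_) (choices ls)) l)) ≡ sumL l (λ a → sumV ls (f ∘ (a ∷_)))
  outer []      = refl
  outer (a ∷ l) = begin
    sum (map f (map (a ∷_) (choices ls) ++ rest))
      ≡⟨ cong sum (map-++ f (map (a ∷_) (choices ls)) rest) ⟩
    sum (map f (map (a ∷_) (choices ls)) ++ map f rest)
      ≡⟨ sum-++ (map f (map (a ∷_) (choices ls))) (map f rest) ⟩
    sum (map f (map (a ∷_) (choices ls))) + sum (map f rest)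
      ≡⟨ cong₂ _+_ (trans (cong sum (sym (map-∘ (choices ls)))) (sum-choices ls (f ∘ (a ∷_)))) (outer l) ⟩
    sumV ls (f ∘ (a ∷_)) + sumL l (λ a → sumV ls (f ∘ (a ∷_))) ∎
    where
    open ≡-Reasoning
    rest = concatMap (λ a → map (a ∷_) (choices ls)) l

InBox : ∀ {m} → Vec (List ℤ) m → Vec ℤ m → Set
InBox ls x = ∀ i → lookup x i ∈ lookup ls i

sumV-cong-∈ : ∀ {m} (ls : Vec (List ℤ) m) {f g} → (∀ x → InBox ls x → f x ≡ g x) → sumV ls f ≡ sumV ls g
sumV-cong-∈ []       h = h [] (λ ())
sumV-cong-∈ (l ∷ ls) h = sumL-cong l λ a a∈ → sumV-cong-∈ ls λ x x∈ →
  h (a ∷ x) λ { zero → a∈ ; (suc i) → x∈ i }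

sumV-cong : ∀ {m} (ls : Vec (List ℤ) m) {f g} → (∀ x → f x ≡ g x) → sumV ls f ≡ sumV ls g
sumV-cong ls h = sumV-cong-∈ ls (λ x _ → h x)

sumV-0 : ∀ {m} (ls : Vec (List ℤ) m) → sumV ls (λ _ → 0) ≡ 0
sumV-0 []       = refl
sumV-0 (l ∷ ls) = trans (sumL-cong l (λ _ _ → sumV-0 ls)) (sumL-0 l)

sumV-+ : ∀ {m} (ls : Vec (List ℤ) m) f g → sumV ls (λ x → f x + g x) ≡ sumV ls f + sumV ls g
sumV-+ []       f g = refl
sumV-+ (l ∷ ls) f g = trans (sumL-cong l (λ a _ → sumV-+ ls (f ∘ (a ∷_)) (g ∘ (a ∷_))))
                            (sumL-+ l (λ a → sumV ls (f ∘ (a ∷_))) (λ a → sumV ls (g ∘ (a ∷_))))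

sumV-empty : ∀ {m} (ls : Vec (List ℤ) m) i f → lookup ls i ≡ [] → sumV ls f ≡ 0
sumV-empty (l ∷ ls) zero    f refl = refl
sumV-empty (l ∷ ls) (suc i) f h    = trans (sumL-cong l (λ a _ → sumV-empty ls i (f ∘ (a ∷_)) h)) (sumL-0 l)

sizes : ∀ {m} → Vec (List ℤ) m → ℕ
sizes []       = 1
sizes (l ∷ ls) = length l * sizes ls

sumV-1 : ∀ {m} (ls : Vec (List ℤ) m) → sumV ls (λ _ → 1) ≡ sizes ls
sumV-1 []       = refl
sumV-1 (l ∷ ls) = trans (sumL-cong l (λ _ _ → sumV-1 ls)) (sumL-const l (sizes ls))

sumV-sumL : ∀ {m} (ls : Vec (List ℤ) m) l (f : ℤ → Vec ℤ m → ℕ) →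
            sumV ls (λ x → sumL l (λ a → f a x)) ≡ sumL l (λ a → sumV ls (f a))
sumV-sumL ls []      f = sumV-0 ls
sumV-sumL ls (a ∷ l) f = trans (sumV-+ ls (f a) _) (cong (sumV ls (f a) +_) (sumV-sumL ls l f))

-- Makes the sum over slot `i` the innermost one. The one-element list left behind keeps the length
-- of the vector and contributes a factor 1.
sumV-at : ∀ {m} (ls : Vec (List ℤ) m) i f →
          sumV ls f ≡ sumV (ls [ i ]≔ [ 0ℤ ]) (λ x → sumL (lookup ls i) (λ a → f (x [ i ]≔ a)))
sumV-at (l ∷ ls) zero    f = sym (trans (+-identityʳ _) (sumV-sumL ls l (λ a x → f (a ∷ x))))
sumV-at (l ∷ ls) (suc i) f = sumL-cong l (λ a _ → sumV-at ls i (f ∘ (a ∷_)))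

sumV-filter : ∀ {m} {P : ℤ → Set} (P? : Decidable P) (ls : Vec (List ℤ) m) j f →
              sumV ls (λ x → when (P? (lookup x j)) (f x)) ≡ sumV (ls [ j ]≔ filter P? (lookup ls j)) f
sumV-filter P? (l ∷ ls) (suc j) f = sumL-cong l (λ a _ → sumV-filter P? ls j (f ∘ (a ∷_)))
sumV-filter P? (l ∷ ls) zero    f = go l
  where
  go : ∀ l → sumL l (λ a → sumV ls (λ x → when (P? a) (f (a ∷ x)))) ≡ sumL (filter P? l) (λ a → sumV ls (f ∘ (a ∷_)))
  go []      = refl
  go (a ∷ l) with P? a
  ... | yes _ = cong (sumV ls (f ∘ (a ∷_)) +_) (go l)
  ... | no  _ = cong₂ _+_ (sumV-0 ls) (go l)

-- Signs, and colourings with identified vertices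

act : Sign → ℤ → ℤ
act pos x = x
act neg x = - x

infixl 7 _·_
_·_ : Sign → Sign → Sign
pos · t   = t
neg · pos = neg
neg · neg = pos

act-· : ∀ s t x → act (s · t) x ≡ act s (act t x)
act-· pos t   x = refl
act-· neg pos x = refl
act-· neg neg x = sym (ℤ.neg-involutive x)

act-involutive : ∀ s x → act s (act s x) ≡ x
act-involutive pos x = refl
act-involutive neg x = ℤ.neg-involutive x

act-flip : ∀ s {x y} → x ≡ act s y → y ≡ act s x
act-flip s {x} {y} refl = sym (act-involutive s y)

act-0 : ∀ s → act s 0ℤ ≡ 0ℤ
act-0 pos = refl
act-0 neg = refl

⟦⟧-act : ∀ s x → ⟦ s ⟧ ℤ.* x ≡ act s x
⟦⟧-act pos x = ℤ.*-identityˡ x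
⟦⟧-act neg x = ℤ.-1*i≡-i x

-- Slot zero always carries the colour 0; vertex v gets the colour
-- act s (lookup x i) when ρ v = (i , s).
Rep : ℕ → Set
Rep n = Fin n → Fin (suc n) × Sign

module _ {n : ℕ} where

  colour : Rep n → Vec ℤ (suc n) → Fin n → ℤ
  colour ρ x v = act (proj₂ (ρ v)) (lookup x (proj₁ (ρ v)))

  Violates : Rep n → Vec ℤ (suc n) → Edge n → Set
  Violates ρ x (u , v , s) = colour ρ x u ≡ act s (colour ρ x v)

  violates? : ∀ ρ x e → Dec (Violates ρ x e)
  violates? ρ x (u , v , s) = colour ρ x u ℤ.≟ act s (colour ρ x v)

  proper : Rep n → List (Edge n) → Vec ℤ (suc n) → ℕ
  proper ρ []      x = 1
  proper ρ (e ∷ R) x = unless (violates? ρ x e) (proper ρ R x)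

  count : Rep n → Vec (List ℤ) (suc n) → List (Edge n) → ℕ
  count ρ β R = sumV β (proper ρ R)

  countViolating : Rep n → Vec (List ℤ) (suc n) → Edge n → List (Edge n) → ℕ
  countViolating ρ β e R = sumV β (λ x → when (violates? ρ x e) (proper ρ R x))

  count-split : ∀ ρ β e R → count ρ β (e ∷ R) + countViolating ρ β e R ≡ count ρ β R
  count-split ρ β e R = trans (sym (sumV-+ β _ _)) (sumV-cong β λ x → unless+when (violates? ρ x e) (proper ρ R x))

  count-always-violated : ∀ ρ β e R → (∀ x → InBox β x → Violates ρ x e) → count ρ β (e ∷ R) ≡ 0
  count-always-violated ρ β e R h = trans (sumV-cong-∈ β vanish) (sumV-0 β)
    where
    vanish : ∀ x → InBox β x → unless (violates? ρ x e) (proper ρ R x) ≡ 0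
    vanish x x∈ with violates? ρ x e
    ... | yes _ = refl
    ... | no ¬p = contradiction (h x x∈) ¬p

  proper-cong : ∀ {ρ ρ′ x y} R → (∀ v → colour ρ x v ≡ colour ρ′ y v) → proper ρ R x ≡ proper ρ′ R y
  proper-cong []      h = refl
  proper-cong {ρ} {ρ′} {x} {y} ((u , v , s) ∷ R) h rewrite h u | h v | proper-cong {ρ} {ρ′} {x} {y} R h = refl

  reroute : Fin (suc n) → Fin (suc n) → Sign → Rep n → Rep n
  reroute i j t ρ v with proj₁ (ρ v) Fin.≟ i
  ... | yes _ = j , proj₂ (ρ v) · t
  ... | no  _ = ρ v

  reroute-≢ : ∀ {i j} t ρ → i ≢ j → ∀ v → proj₁ (reroute i j t ρ v) ≢ i
  reroute-≢ {i} t ρ i≢j v with proj₁ (ρ v) Fin.≟ i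
  ... | yes _ = i≢j ∘ sym
  ... | no  p = p

  mergeLists : Fin (suc n) → Fin (suc n) → Sign → Vec (List ℤ) (suc n) → Vec (List ℤ) (suc n)
  mergeLists i j t β = (β [ i ]≔ [ 0ℤ ]) [ j ]≔ filter (λ y → act t y ∈? lookup β i) (lookup β j)

  -- Only `x` with 0 in slot zero are ever summed over. Relative to these, an edge that forces a
  -- slot to be 0 is also an identification, with `j = zero`.
  Identifies : Rep n → Edge n → Fin (suc n) → Fin (suc n) → Sign → Set
  Identifies ρ e i j t = ∀ x → lookup x zero ≡ 0ℤ → Violates ρ x e ⇔ lookup x i ≡ act t (lookup x j)

  -- Contraction of `e`. Violation determines slot `i` from slot `j`, so summing out slot `i` leaves
  -- the condition that the forced colour is in its list; by uniqueness it is found there at most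
  -- once.
  countViolating-merge : ∀ {ρ β e i j t} R → Unique (lookup β i) → i ≢ j → lookup β zero ≡ [ 0ℤ ] →
    Identifies ρ e i j t → countViolating ρ β e R ≡ count (reroute i j t ρ) (mergeLists i j t β) R
  countViolating-merge {ρ} {β} {e} {i} {j} {t} R uniq i≢j β₀ ident = begin
    countViolating ρ β e R
      ≡⟨ sumV-cong-∈ β (λ x x∈ → when-⇔ (violates? ρ x e) (lookup x i ℤ.≟ act t (lookup x j))
           (ident x (zero-slot (subst (lookup x zero ∈_) β₀ (x∈ zero))))
           (λ eq → proper-cong {ρ} {ρ′} {x} {x} R (rerouted x eq))) ⟩
    sumV β F
      ≡⟨ sumV-at β i F ⟩
    sumV (β [ i ]≔ [ 0ℤ ]) (λ x → sumL (lookup β i) (λ a → F (x [ i ]≔ a)))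
      ≡⟨ sumV-cong (β [ i ]≔ [ 0ℤ ]) (λ x → trans (sumL-cong (lookup β i) (λ a _ → unchanged x a))
           (sumL-≟ (act t (lookup x j)) (lookup β i) (proper ρ′ R x) uniq)) ⟩
    sumV (β [ i ]≔ [ 0ℤ ]) (λ x → when (act t (lookup x j) ∈? lookup β i) (proper ρ′ R x))
      ≡⟨ sumV-filter (λ y → act t y ∈? lookup β i) (β [ i ]≔ [ 0ℤ ]) j (proper ρ′ R) ⟩
    count ρ′ ((β [ i ]≔ [ 0ℤ ]) [ j ]≔ filter (λ y → act t y ∈? lookup β i) (lookup (β [ i ]≔ [ 0ℤ ]) j)) R
      ≡⟨ cong (λ l → count ρ′ ((β [ i ]≔ [ 0ℤ ]) [ j ]≔ filter (λ y → act t y ∈? lookup β i) l) R)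
           (lookup∘updateAt′ j i (i≢j ∘ sym) β) ⟩
    count ρ′ (mergeLists i j t β) R ∎
    where
    open ≡-Reasoning
    ρ′ = reroute i j t ρ
    F : Vec ℤ (suc n) → ℕ
    F x = when (lookup x i ℤ.≟ act t (lookup x j)) (proper ρ′ R x)
    zero-slot : ∀ {y} → y ∈ [ 0ℤ ] → y ≡ 0ℤ
    zero-slot (here p) = p
    rerouted : ∀ x → lookup x i ≡ act t (lookup x j) → ∀ v → colour ρ x v ≡ colour ρ′ x v
    rerouted x eq v with proj₁ (ρ v) Fin.≟ i
    ... | yes p = trans (cong (act (proj₂ (ρ v))) (trans (cong (lookup x) p) eq)) (sym (act-· (proj₂ (ρ v)) t _))
    ... | no  _ = refl
    -- After rerouting no vertex reads slot `i`, so overwriting it affects the test alone.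
    unchanged : ∀ x a → F (x [ i ]≔ a) ≡ when (a ℤ.≟ act t (lookup x j)) (proper ρ′ R x)
    unchanged x a rewrite lookup∘updateAt i {λ _ → a} x | lookup∘updateAt′ j i {λ _ → a} (i≢j ∘ sym) x =
      cong (when (a ℤ.≟ act t (lookup x j)))
        (proper-cong {ρ′} {ρ′} {x [ i ]≔ a} {x} R (λ v → cong (act (proj₂ (ρ′ v)))
          (lookup∘updateAt′ (proj₁ (ρ′ v)) i (reroute-≢ t ρ i≢j v) x)))

-- Contraction of violated edges

unique-⊆-length : ∀ {xs ys : List ℤ} → Unique xs → (∀ {a} → a ∈ xs → a ∈ ys) → length xs ≤ length ys
unique-⊆-length {[]}     _ _ = z≤n
unique-⊆-length {x ∷ xs} {ys} (x≢ ∷ u) sub with ∈-∃++ (sub (here refl))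
... | ys₁ , ys₂ , refl = begin
  suc (length xs)               ≤⟨ s≤s (unique-⊆-length u sub′) ⟩
  suc (length (ys₁ ++ ys₂))     ≡⟨ cong suc (length-++ ys₁) ⟩
  suc (length ys₁ + length ys₂) ≡⟨ +-suc (length ys₁) (length ys₂) ⟨
  length ys₁ + suc (length ys₂) ≡⟨ length-++ ys₁ ⟨
  length (ys₁ ++ x ∷ ys₂)       ∎
  where
  open ≤-Reasoning
  sub′ : ∀ {a} → a ∈ xs → a ∈ ys₁ ++ ys₂
  sub′ a∈ with ∈-++⁻ ys₁ (sub (there a∈))
  ... | inj₁ p            = ∈-++⁺ˡ p
  ... | inj₂ (here refl)  = contradiction refl (All.lookup x≢ a∈)
  ... | inj₂ (there p)    = ∈-++⁺ʳ ys₁ p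

length-filter-¬? : ∀ {P : ℤ → Set} (P? : Decidable P) xs →
                   length (filter P? xs) + length (filter (¬? ∘ P?) xs) ≡ length xs
length-filter-¬? P? []       = refl
length-filter-¬? P? (x ∷ xs) with P? x
... | yes _ = cong suc (length-filter-¬? P? xs)
... | no  _ = trans (+-suc _ _) (cong suc (length-filter-¬? P? xs))

inclusion-exclusion : ∀ {X Y Z : List ℤ} → Unique X → Unique Y →
  (∀ {a} → a ∈ X → a ∈ Z) → (∀ {a} → a ∈ Y → a ∈ Z) →
  length X + length Y ≤ length (filter (_∈? Y) X) + length Z
inclusion-exclusion {X} {Y} {Z} uX uY X⊆Z Y⊆Z = begin
  length X + length Y                                    ≡⟨ cong (_+ length Y) (length-filter-¬? (_∈? Y) X) ⟨
  length X∩Y + length X∖Y + length Y                     ≡⟨ +-assoc (length X∩Y) (length X∖Y) (length Y) ⟩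
  length X∩Y + (length X∖Y + length Y)                   ≡⟨ cong (λ l → length X∩Y + l) (length-++ X∖Y) ⟨
  length X∩Y + length (X∖Y ++ Y)                         ≤⟨ +-monoʳ-≤ (length X∩Y) (unique-⊆-length uX∪Y sub) ⟩
  length X∩Y + length Z                                  ∎
  where
  open ≤-Reasoning
  X∩Y = filter (_∈? Y) X
  X∖Y = filter (¬? ∘ (_∈? Y)) X
  uX∪Y : Unique (X∖Y ++ Y)
  uX∪Y = Unique.++⁺ (Unique.filter⁺ (¬? ∘ (_∈? Y)) uX) uY
           λ (p , q) → proj₂ (∈-filter⁻ (¬? ∘ (_∈? Y)) {xs = X} p) q
  sub : ∀ {a} → a ∈ X∖Y ++ Y → a ∈ Z
  sub p with ∈-++⁻ X∖Y p
  ... | inj₁ q = X⊆Z (proj₁ (∈-filter⁻ (¬? ∘ (_∈? Y)) {xs = X} q))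
  ... | inj₂ q = Y⊆Z q

act-injective : ∀ s {x y} → act s x ≡ act s y → x ≡ y
act-injective s {x} {y} eq = trans (sym (act-involutive s x)) (trans (cong (act s) eq) (act-involutive s y))

act≡0 : ∀ s {x} → act s x ≡ 0ℤ → x ≡ 0ℤ
act≡0 s eq = act-injective s (trans eq (sym (act-0 s)))

unique-map-act : ∀ s {l} → Unique l → Unique (map (act s) l)
unique-map-act s = Unique.map⁺ (act-injective s)

common : Sign → List ℤ → List ℤ → List ℤ
common s A B = filter (λ z → act s z ∈? A) B

-- Deficits add up under merging. `C`, the part of `B` that `s` carries into `A`, misses at most `α`
-- elements of `B`. Inclusion-exclusion inside `B` intersects it with the image of `Y` at a cost of
-- `d′`, then inside `A` with the image of `X` at a cost of `d`. What survives is transported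
-- injectively into `common t X Y`.
common-merge : ∀ {k A B X Y d d′ α} s₁ s s₂ → Unique B → length A ≡ k → length B ≡ k →
  Unique X → (∀ {y} → y ∈ X → act s₁ y ∈ A) → k ≤ length X + d →
  Unique Y → (∀ {y} → y ∈ Y → act s₂ y ∈ B) → k ≤ length Y + d′ →
  k ≤ length (common s A B) + α →
  k ≤ length (common (s₁ · s · s₂) X Y) + (d + d′ + α)
common-merge {k} {A} {B} {X} {Y} {d} {d′} {α} s₁ s s₂ uB |A| |B| uX X⊆ X≥ uY Y⊆ Y≥ C≥ =
  +-cancelʳ-≤ (c + c₁ + q + p + (k + k)) _ _ (begin
    k + (c + c₁ + q + p + (k + k))
      ≡⟨ lem₁ k c c₁ q p ⟩
    (c + q) + (c₁ + p) + k + k + k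
      ≤⟨ +-mono-≤ (+-mono-≤ (+-mono-≤ (+-mono-≤ in-B in-A) X≥) Y≥) C≥ ⟩
    (c₁ + k) + (c₂ + k) + (p + d) + (q + d′) + (c + α)
      ≤⟨ +-monoˡ-≤ (c + α) (+-monoˡ-≤ (q + d′) (+-monoˡ-≤ (p + d) (+-monoʳ-≤ (c₁ + k) (+-monoˡ-≤ k to-Y)))) ⟩
    (c₁ + k) + (r + k) + (p + d) + (q + d′) + (c + α)
      ≡⟨ lem₂ k c c₁ q p r d d′ α ⟩
    r + (d + d′ + α) + (c + c₁ + q + p + (k + k)) ∎)
  where
  open ≤-Reasoning
  t = s₁ · s · s₂
  P? = λ z → act s z ∈? A
  C = common s A B
  Y′ = map (act s₂) Y
  C₁ = filter (_∈? Y′) C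
  X′ = map (act s₁) X
  D = map (act s) C₁
  C₂ = filter (_∈? X′) D
  c = length C
  c₁ = length C₁
  c₂ = length C₂
  p = length X
  q = length Y
  r = length (common t X Y)
  lem₁ : ∀ k c c₁ q p → k + (c + c₁ + q + p + (k + k)) ≡ (c + q) + (c₁ + p) + k + k + k
  lem₁ = solve-∀
  lem₂ : ∀ k c c₁ q p r d d′ α → (c₁ + k) + (r + k) + (p + d) + (q + d′) + (c + α) ≡ r + (d + d′ + α) + (c + c₁ + q + p + (k + k))
  lem₂ = solve-∀
  uC : Unique C
  uC = Unique.filter⁺ P? uB
  uC₁ : Unique C₁
  uC₁ = Unique.filter⁺ (_∈? Y′) uC
  Y′⊆B : ∀ {a} → a ∈ Y′ → a ∈ B
  Y′⊆B a∈ with ∈-map⁻ (act s₂) a∈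
  ... | y , y∈ , refl = Y⊆ y∈
  X′⊆A : ∀ {a} → a ∈ X′ → a ∈ A
  X′⊆A a∈ with ∈-map⁻ (act s₁) a∈
  ... | y , y∈ , refl = X⊆ y∈
  D⊆A : ∀ {a} → a ∈ D → a ∈ A
  D⊆A a∈ with ∈-map⁻ (act s) a∈
  ... | z , z∈ , refl = proj₂ (∈-filter⁻ P? {xs = B} (proj₁ (∈-filter⁻ (_∈? Y′) {xs = C} z∈)))
  in-B : c + q ≤ c₁ + k
  in-B = subst₂ (λ m l → c + m ≤ c₁ + l) (length-map (act s₂) Y) |B|
    (inclusion-exclusion {C} {Y′} {B} uC (unique-map-act s₂ uY) (λ a∈ → proj₁ (∈-filter⁻ P? {xs = B} a∈)) Y′⊆B)
  in-A : c₁ + p ≤ c₂ + k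
  in-A = subst₂ (λ m l → m ≤ c₂ + l) (cong₂ _+_ (length-map (act s) C₁) (length-map (act s₁) X)) |A|
    (inclusion-exclusion {D} {X′} {A} (unique-map-act s uC₁) (unique-map-act s₁ uX) D⊆A X′⊆A)
  back : ∀ {a} → a ∈ map (act s₂) (map (act s) C₂) → a ∈ common t X Y
  back a∈ with ∈-map⁻ (act s₂) a∈
  ... | _ , b∈ , refl with ∈-map⁻ (act s) b∈
  ... | z , z∈C₂ , refl with ∈-filter⁻ (_∈? X′) {xs = D} z∈C₂
  ... | z∈D , z∈X′ with ∈-map⁻ (act s₁) z∈X′ | ∈-map⁻ (act s) z∈D
  ... | x , x∈X , z≡x | w , w∈C₁ , z≡w with ∈-map⁻ (act s₂) (proj₂ (∈-filter⁻ (_∈? Y′) {xs = C} w∈C₁))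
  ... | y , y∈Y , w≡y = subst (_∈ common t X Y) (sym here≡y) (∈-filter⁺ (λ z → act t z ∈? X) y∈Y (subst (_∈ X) (sym ty≡x) x∈X))
    where
    here≡y : act s₂ (act s z) ≡ y
    here≡y = trans (cong (act s₂) (sym (act-flip s z≡w))) (sym (act-flip s₂ w≡y))
    ty≡x : act t y ≡ x
    ty≡x = trans (act-· (s₁ · s) s₂ y) (trans (act-· s₁ s (act s₂ y))
      (trans (cong (act s₁ ∘ act s) (sym w≡y)) (trans (cong (act s₁) (sym z≡w)) (sym (act-flip s₁ z≡x)))))
  to-Y : c₂ ≤ r
  to-Y = subst (_≤ r) (trans (length-map (act s₂) (map (act s) C₂)) (length-map (act s) C₂))
    (unique-⊆-length (unique-map-act s₂ (unique-map-act s (Unique.filter⁺ (_∈? X′) (unique-map-act s uC₁)))) back)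

-- One flag lets both parities of `k` share the argument. Merging preserves it, and it decides
-- whether a slot forced to be 0 admits a colouring.
HasZero : Bool → List ℤ → Set
HasZero true  l = 0ℤ ∈ l
HasZero false l = 0ℤ ∉ l

common-HasZero : ∀ b t {X Y} → HasZero b X → HasZero b Y → HasZero b (common t X Y)
common-HasZero true  t {X} 0∈X 0∈Y = ∈-filter⁺ (λ z → act t z ∈? X) 0∈Y (subst (_∈ X) (sym (act-0 t)) 0∈X)
common-HasZero false t {X} {Y} _ 0∉Y 0∈ = 0∉Y (proj₁ (∈-filter⁻ (λ z → act t z ∈? X) {xs = Y} 0∈))

sum-updateAt : ∀ {m} (d : Vec ℕ m) i x → Vec.sum (d [ i ]≔ x) + lookup d i ≡ Vec.sum d + x
sum-updateAt (y ∷ d) zero    x = lem x (Vec.sum d) y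
  where
  lem : ∀ x z y → x + z + y ≡ y + z + x
  lem = solve-∀
sum-updateAt (y ∷ d) (suc i) x = trans (+-assoc y _ _) (trans (cong (λ z → y + z) (sum-updateAt d i x)) (sym (+-assoc y _ x)))

-- Invariants of contraction: live slots and their deficits

module Merging (k : ℕ) (b : Bool) where

  -- Slot zero and the slots already merged into another one are dead: they keep
  -- their place with the single colour 0, which does not affect the count.
  data Slot : Bool → List ℤ → ℕ → Set where
    dead : Slot false [ 0ℤ ] 0
    live : ∀ {l d} → Unique l → HasZero b l → length l ≤ k → k ≤ length l + d → Slot true l d

  volume : ∀ {m} → Vec Bool m → ℕ
  volume []          = 1
  volume (true ∷ a)  = k * volume a
  volume (false ∷ a) = volume a

  Slots : ∀ {m} → Vec Bool m → Vec (List ℤ) m → Vec ℕ m → Set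
  Slots alive β d = ∀ i → Slot (lookup alive i) (lookup β i) (lookup d i)

  sizes≤volume : ∀ {m} (alive : Vec Bool m) β d → Slots alive β d → sizes β ≤ volume alive
  sizes≤volume []      []      []      _ = ≤-refl
  sizes≤volume (x ∷ a) (l ∷ β) (y ∷ d) S with x | l | y | S zero | sizes≤volume a β d (S ∘ suc)
  ... | _ | _ | _ | dead           | ih = ≤-trans (≤-reflexive (+-identityʳ _)) ih
  ... | _ | _ | _ | live _ _ l≤k _ | ih = *-mono-≤ l≤k ih

  -- Weierstrass' product inequality ∏ (1 - dᵢ / k) ≥ 1 - ∑ dᵢ / k.
  volume≤sizes : ∀ {m} (alive : Vec Bool m) β d → Slots alive β d →
                 k * volume alive ≤ k * sizes β + volume alive * Vec.sum d
  volume≤sizes []      []      []      _ = m≤m+n _ _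
  volume≤sizes (x ∷ a) (l ∷ β) (y ∷ d) S
    with x | l | y | S zero | volume≤sizes a β d (S ∘ suc) | sizes≤volume a β d (S ∘ suc)
  ... | _ | _ | _ | dead             | ih | _     = subst (λ z → k * volume a ≤ k * z + volume a * Vec.sum d) (sym (+-identityʳ _)) ih
  ... | _ | l | y | live _ _ l≤k k≤ | ih | P′≤W = begin
    k * (k * W)                            ≤⟨ *-monoʳ-≤ k ih ⟩
    k * (k * P′ + W * D)                   ≡⟨ lem₁ k P′ W D ⟩
    k * k * P′ + k * W * D                 ≤⟨ +-monoˡ-≤ (k * W * D) (*-monoˡ-≤ P′ (*-monoʳ-≤ k k≤)) ⟩
    k * (length l + y) * P′ + k * W * D    ≡⟨ lem₂ k (length l) y P′ W D ⟩
    k * (length l * P′) + k * y * P′ + k * W * D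
      ≤⟨ +-monoˡ-≤ (k * W * D) (+-monoʳ-≤ (k * (length l * P′)) (*-monoʳ-≤ (k * y) P′≤W)) ⟩
    k * (length l * P′) + k * y * W + k * W * D ≡⟨ lem₃ k (length l * P′) y W D ⟩
    k * (length l * P′) + k * W * (y + D)  ∎
    where
    open ≤-Reasoning
    W = volume a
    P′ = sizes β
    D = Vec.sum d
    lem₁ : ∀ k p w d → k * (k * p + w * d) ≡ k * k * p + k * w * d
    lem₁ = solve-∀
    lem₂ : ∀ k l y p w d → k * (l + y) * p + k * w * d ≡ k * (l * p) + k * y * p + k * w * d
    lem₂ = solve-∀
    lem₃ : ∀ k x y w d → k * x + k * y * w + k * w * d ≡ k * x + k * w * (y + d)
    lem₃ = solve-∀

  volume-kill : ∀ {m} (alive : Vec Bool m) i → lookup alive i ≡ true → volume alive ≡ k * volume (alive [ i ]≔ false)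
  volume-kill (true ∷ a)  zero    _ = refl
  volume-kill (true ∷ a)  (suc i) h = cong (k *_) (volume-kill a i h)
  volume-kill (false ∷ a) (suc i) h = volume-kill a i h

  module _ {n : ℕ} where

    -- What the two assignments under comparison share, being contracted along the same edges.
    -- `scaled` expresses `volume alive = k^(n - s)` after `s` contractions, free of subtraction.
    record Shape (ρ : Rep n) (alive : Vec Bool (suc n)) (s : ℕ) : Set where
      field
        zero-dead : lookup alive zero ≡ false
        used      : ∀ v → proj₁ (ρ v) ≡ zero ⊎ lookup alive (proj₁ (ρ v)) ≡ true
        scaled    : k ^ s * volume alive ≡ k ^ n

    -- `a` is the budget of deficits, the sum of `α` over the violated edges. `contained` lets
    -- `common-merge` compare slot lists with the original ones; it speaks of live slots only, since
    -- a vertex in slot zero never takes part in a merge.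
    record Fits (L : Vec (List ℤ) n) (ρ : Rep n) (alive : Vec Bool (suc n)) (β : Vec (List ℤ) (suc n)) (a : ℕ) : Set where
      field
        deficit   : Vec ℕ (suc n)
        deficit≤  : Vec.sum deficit ≤ a
        slots     : Slots alive β deficit
        contained : ∀ v → lookup alive (proj₁ (ρ v)) ≡ true →
                    ∀ {y} → y ∈ lookup β (proj₁ (ρ v)) → act (proj₂ (ρ v)) y ∈ lookup L v

    live-slot : ∀ (alive : Vec Bool (suc n)) β d i → Slots alive β d → lookup alive i ≡ true → Slot true (lookup β i) (lookup d i)
    live-slot alive β d i S p = subst (λ c → Slot c (lookup β i) (lookup d i)) p (S i)

    zero-list : ∀ {ρ alive s L β a} → Shape ρ alive s → Fits L ρ alive β a → lookup β zero ≡ [ 0ℤ ]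
    zero-list {β = β} sh f with lookup β zero | lookup (Fits.deficit f) zero | subst (λ c → Slot c (lookup β zero) (lookup (Fits.deficit f) zero)) (Shape.zero-dead sh) (Fits.slots f zero)
    ... | _ | _ | dead = refl

    live-unique : ∀ {ρ alive L β a} i → Fits L ρ alive β a → lookup alive i ≡ true → Unique (lookup β i)
    live-unique {alive = alive} {β = β} i f p with live-slot alive β (Fits.deficit f) i (Fits.slots f) p
    ... | live u _ _ _ = u

    live-HasZero : ∀ {ρ alive L β a} i → Fits L ρ alive β a → lookup alive i ≡ true → HasZero b (lookup β i)
    live-HasZero {alive = alive} {β = β} i f p with live-slot alive β (Fits.deficit f) i (Fits.slots f) p
    ... | live _ z _ _ = z

    shape-merge : ∀ {ρ alive s i j} t → Shape ρ alive s → lookup alive i ≡ true → i ≢ j →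
                  j ≡ zero ⊎ lookup alive j ≡ true → Shape (reroute i j t ρ) (alive [ i ]≔ false) (suc s)
    shape-merge {ρ} {alive} {s} {i} {j} t sh i-live i≢j j-ok = record
      { zero-dead = trans (lookup∘updateAt′ zero i zero≢i alive) (Shape.zero-dead sh)
      ; used = used
      ; scaled = trans (lem k (k ^ s) (volume (alive [ i ]≔ false)))
                 (trans (cong (k ^ s *_) (sym (volume-kill alive i i-live))) (Shape.scaled sh))
      }
      where
      lem : ∀ k x v → k * x * v ≡ x * (k * v)
      lem = solve-∀
      zero≢i : zero ≢ i
      zero≢i refl with trans (sym i-live) (Shape.zero-dead sh)
      ... | ()
      used : ∀ v → proj₁ (reroute i j t ρ v) ≡ zero ⊎ lookup (alive [ i ]≔ false) (proj₁ (reroute i j t ρ v)) ≡ true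
      used v with proj₁ (ρ v) Fin.≟ i
      used v | yes _ = [ inj₁ , (λ p → inj₂ (trans (lookup∘updateAt′ j i (i≢j ∘ sym) alive) p)) ]′ j-ok
      used v | no ¬p = [ inj₁ , (λ p → inj₂ (trans (lookup∘updateAt′ (proj₁ (ρ v)) i ¬p alive) p)) ]′ (Shape.used sh v)

    -- Slot `j` takes over both old deficits plus `α` while slot `i` drops to 0, so the total grows
    -- by exactly `α`.
    fits-merge : ∀ {ρ alive L β a α} (e : Edge n) → let (u , v , s) = e; i = proj₁ (ρ u); j = proj₁ (ρ v); t = proj₂ (ρ u) · s · proj₂ (ρ v) in
      Fits L ρ alive β a → (∀ v → Unique (lookup L v) × length (lookup L v) ≡ k) →
      i ≢ j → lookup alive i ≡ true → lookup alive j ≡ true →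
      k ≤ length (common s (lookup L u) (lookup L v)) + α →
      Fits L (reroute i j t ρ) (alive [ i ]≔ false) (mergeLists i j t β) (a + α)
    fits-merge {ρ} {alive} {L} {β} {a} {α} (u , v , s) f kL i≢j i-live j-live C≥ = record
      { deficit = d′
      ; deficit≤ = deficit≤′
      ; slots = slots′
      ; contained = contained′
      }
      where
      open Fits f
      i = proj₁ (ρ u)
      j = proj₁ (ρ v)
      t = proj₂ (ρ u) · s · proj₂ (ρ v)
      D = lookup deficit i + lookup deficit j + α
      d′ = (deficit [ i ]≔ 0) [ j ]≔ D
      alive′ = alive [ i ]≔ false
      β′ = mergeLists i j t β
      j≢i : j ≢ i
      j≢i = i≢j ∘ sym
      deficit≤′ : Vec.sum d′ ≤ a + α
      deficit≤′ = ≤-trans (≤-reflexive (+-cancelʳ-≡ (lookup deficit i + lookup deficit j) _ _ (begin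
        Vec.sum d′ + (lookup deficit i + lookup deficit j)
          ≡⟨ lem₁ (Vec.sum d′) (lookup deficit i) (lookup deficit j) ⟩
        Vec.sum d′ + lookup deficit j + lookup deficit i
          ≡⟨ cong (λ z → Vec.sum d′ + z + lookup deficit i) (lookup∘updateAt′ j i j≢i deficit) ⟨
        Vec.sum d′ + lookup (deficit [ i ]≔ 0) j + lookup deficit i
          ≡⟨ cong (_+ lookup deficit i) (sum-updateAt (deficit [ i ]≔ 0) j D) ⟩
        Vec.sum (deficit [ i ]≔ 0) + D + lookup deficit i
          ≡⟨ lem₂ (Vec.sum (deficit [ i ]≔ 0)) D (lookup deficit i) ⟩
        Vec.sum (deficit [ i ]≔ 0) + lookup deficit i + D
          ≡⟨ cong (_+ D) (sum-updateAt deficit i 0) ⟩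
        Vec.sum deficit + 0 + D
          ≡⟨ lem₃ (Vec.sum deficit) (lookup deficit i) (lookup deficit j) α ⟩
        Vec.sum deficit + α + (lookup deficit i + lookup deficit j) ∎))) (+-monoˡ-≤ α deficit≤)
        where
        open ≡-Reasoning
        lem₁ : ∀ x y z → x + (y + z) ≡ x + z + y
        lem₁ = solve-∀
        lem₂ : ∀ x y z → x + y + z ≡ x + z + y
        lem₂ = solve-∀
        lem₃ : ∀ x y z w → x + 0 + (y + z + w) ≡ x + w + (y + z)
        lem₃ = solve-∀
      merged : Slot true (common t (lookup β i) (lookup β j)) D
      merged with live-slot alive β deficit i slots i-live | live-slot alive β deficit j slots j-live
      ... | live uᵢ zᵢ _ ≥ᵢ | live uⱼ zⱼ ≤ⱼ ≥ⱼ = live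
        (Unique.filter⁺ (λ z → act t z ∈? lookup β i) uⱼ)
        (common-HasZero b t zᵢ zⱼ)
        (≤-trans (length-filter (λ z → act t z ∈? lookup β i) (lookup β j)) ≤ⱼ)
        (common-merge (proj₂ (ρ u)) s (proj₂ (ρ v)) (proj₁ (kL v)) (proj₂ (kL u)) (proj₂ (kL v))
          uᵢ (contained u i-live) ≥ᵢ uⱼ (contained v j-live) ≥ⱼ C≥)
      slots′ : Slots alive′ β′ d′
      slots′ l with l Fin.≟ j
      ... | yes refl rewrite lookup∘updateAt′ j i {λ _ → false} j≢i alive | j-live
                           | lookup∘updateAt j {λ _ → common t (lookup β i) (lookup β j)} (β [ i ]≔ [ 0ℤ ])
                           | lookup∘updateAt j {λ _ → D} (deficit [ i ]≔ 0) = merged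
      ... | no l≢j rewrite lookup∘updateAt′ l j {λ _ → common t (lookup β i) (lookup β j)} l≢j (β [ i ]≔ [ 0ℤ ])
                         | lookup∘updateAt′ l j {λ _ → D} l≢j (deficit [ i ]≔ 0) with l Fin.≟ i
      ...   | yes refl rewrite lookup∘updateAt i {λ _ → false} alive | lookup∘updateAt i {λ _ → [ 0ℤ ]} β
                             | lookup∘updateAt i {λ _ → 0} deficit = dead
      ...   | no l≢i rewrite lookup∘updateAt′ l i {λ _ → false} l≢i alive | lookup∘updateAt′ l i {λ _ → [ 0ℤ ]} l≢i β
                           | lookup∘updateAt′ l i {λ _ → 0} l≢i deficit = slots l
      contained′ : ∀ w → lookup alive′ (proj₁ (reroute i j t ρ w)) ≡ true →
                   ∀ {y} → y ∈ lookup β′ (proj₁ (reroute i j t ρ w)) → act (proj₂ (reroute i j t ρ w)) y ∈ lookup L w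
      contained′ w p {y} y∈ with proj₁ (ρ w) Fin.≟ i
      ... | yes eq rewrite lookup∘updateAt j {λ _ → common t (lookup β i) (lookup β j)} (β [ i ]≔ [ 0ℤ ]) =
        subst (_∈ lookup L w) (sym (act-· (proj₂ (ρ w)) t y))
          (contained w (trans (cong (lookup alive) eq) i-live)
            (subst (λ l → act t y ∈ lookup β l) (sym eq) (proj₂ (∈-filter⁻ (λ z → act t z ∈? lookup β i) {xs = lookup β j} y∈))))
      ... | no ≢i with proj₁ (ρ w) Fin.≟ j
      ...   | yes eq = contained w (trans (cong (lookup alive) eq) j-live)
        (subst (λ l → y ∈ lookup β l) (sym eq) (proj₁ (∈-filter⁻ (λ z → act t z ∈? lookup β i) {xs = lookup β j}
          (subst (y ∈_) (trans (cong (lookup β′) eq) (lookup∘updateAt j (β [ i ]≔ [ 0ℤ ]))) y∈))))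
      ...   | no ≢j = contained w (trans (sym (lookup∘updateAt′ (proj₁ (ρ w)) i ≢i alive)) p)
        (subst (y ∈_) (trans (lookup∘updateAt′ (proj₁ (ρ w)) j ≢j (β [ i ]≔ [ 0ℤ ])) (lookup∘updateAt′ (proj₁ (ρ w)) i ≢i β)) y∈)

x≡-x⇒x≡0 : ∀ {x} → x ≡ - x → x ≡ 0ℤ
x≡-x⇒x≡0 {ℤ.+ zero} _ = refl

common-zero : ∀ t {X} → 0ℤ ∈ X → common t X [ 0ℤ ] ≡ [ 0ℤ ]
common-zero t {X} 0∈X = filter-accept (λ z → act t z ∈? X) {xs = []} (subst (_∈ X) (sym (act-0 t)) 0∈X)

common-zero-∉ : ∀ t {X} → 0ℤ ∉ X → common t X [ 0ℤ ] ≡ []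
common-zero-∉ t {X} 0∉X = filter-reject (λ z → act t z ∈? X) {xs = []} (0∉X ∘ subst (_∈ X) (act-0 t))

-- One deletion-contraction step for two assignments at once. The contracted counts `p′` and `q′`
-- are subtracted, hence compared in the opposite direction; `G` and `G′` are gains carried along.
branch-≤ : ∀ {P p′ p Q q′ q} E k N u w G G′ → P + p′ ≡ p → Q + q′ ≡ q →
  E * p + G ≤ E * q + N * u → k * E * q′ + G′ ≤ k * E * p′ + N * w →
  k * E * P + (k * G + G′) ≤ k * E * Q + N * (k * u + w)
branch-≤ {P} {p′} {_} {Q} {q′} E k N u w G G′ refl refl h h′ = +-cancelʳ-≤ (k * E * p′) _ _ (begin
  k * E * P + (k * G + G′) + k * E * p′         ≡⟨ lem₁ k E P p′ G G′ ⟩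
  k * (E * (P + p′) + G) + G′                   ≤⟨ +-monoˡ-≤ G′ (*-monoʳ-≤ k h) ⟩
  k * (E * (Q + q′) + N * u) + G′               ≡⟨ lem₂ k E Q q′ N u G′ ⟩
  k * E * Q + k * N * u + (k * E * q′ + G′)     ≤⟨ +-monoʳ-≤ (k * E * Q + k * N * u) h′ ⟩
  k * E * Q + k * N * u + (k * E * p′ + N * w)  ≡⟨ lem₃ k E Q p′ N u w ⟩
  k * E * Q + N * (k * u + w) + k * E * p′      ∎)
  where
  open ≤-Reasoning
  lem₁ : ∀ k E P p′ G G′ → k * E * P + (k * G + G′) + k * E * p′ ≡ k * (E * (P + p′) + G) + G′
  lem₁ = solve-∀
  lem₂ : ∀ k E Q q′ N u G′ → k * (E * (Q + q′) + N * u) + G′ ≡ k * E * Q + k * N * u + (k * E * q′ + G′)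
  lem₂ = solve-∀
  lem₃ : ∀ k E Q p′ N u w → k * E * Q + k * N * u + (k * E * p′ + N * w) ≡ k * E * Q + N * (k * u + w) + k * E * p′
  lem₃ = solve-∀

branch-≤₀ : ∀ {P p′ p Q q′ q} E k N u w → P + p′ ≡ p → Q + q′ ≡ q →
  E * p ≤ E * q + N * u → k * E * q′ ≤ k * E * p′ + N * w → k * E * P ≤ k * E * Q + N * (k * u + w)
branch-≤₀ E k N u w eq eq′ h h′ = ≤-trans (m≤m+n _ (k * 0 + 0))
  (branch-≤ E k N u w 0 0 eq eq′ (≤-trans (≤-reflexive (+-identityʳ _)) h) (≤-trans (≤-reflexive (+-identityʳ _)) h′))

sizes-updateAt : ∀ {m} (β : Vec (List ℤ) m) i l → sizes (β [ i ]≔ l) * length (lookup β i) ≡ sizes β * length l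
sizes-updateAt (x ∷ β) zero    l = lem (length l) (sizes β) (length x)
  where
  lem : ∀ l s x → l * s * x ≡ x * s * l
  lem = solve-∀
sizes-updateAt (x ∷ β) (suc i) l = trans (*-assoc (length x) _ _)
  (trans (cong (λ z → length x * z) (sizes-updateAt β i l)) (sym (*-assoc (length x) _ _)))

identifies-merge : ∀ {n} (ρ : Rep n) (e : Edge n) → let (u , v , s) = e; t = proj₂ (ρ u) · s · proj₂ (ρ v) in
                   Identifies ρ e (proj₁ (ρ u)) (proj₁ (ρ v)) t
identifies-merge ρ (u , v , s) x _ = mk⇔
  (λ p → trans (act-flip s₁ (sym p)) (sym (expand _)))
  (λ p → sym (act-flip s₁ (trans p (expand _))))
  where
  s₁ = proj₂ (ρ u)
  s₂ = proj₂ (ρ v)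
  expand : ∀ y → act (s₁ · s · s₂) y ≡ act s₁ (act s (act s₂ y))
  expand y = trans (act-· (s₁ · s) s₂ y) (act-· s₁ s (act s₂ y))

-- For an edge with both ends in one slot: if the signs multiply to `pos`, it closes a balanced
-- cycle of violated edges and is violated by every colour; otherwise the condition is `x = - x`.
same-slot : ∀ s₁ s s₂ → (∀ x → act s₁ x ≡ act s (act s₂ x)) ⊎ (∀ x → act s₁ x ≡ act s (act s₂ x) → x ≡ 0ℤ)
same-slot pos pos pos = inj₁ λ x → refl
same-slot pos pos neg = inj₂ λ x → x≡-x⇒x≡0
same-slot pos neg pos = inj₂ λ x → x≡-x⇒x≡0
same-slot pos neg neg = inj₁ λ x → sym (ℤ.neg-involutive x)
same-slot neg pos pos = inj₂ λ x → x≡-x⇒x≡0 ∘ sym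
same-slot neg pos neg = inj₁ λ x → refl
same-slot neg neg pos = inj₁ λ x → refl
same-slot neg neg neg = inj₂ λ x p → x≡-x⇒x≡0 (trans (sym (ℤ.neg-involutive x)) (sym p))

-- The three possible effects of violating an edge

module _ (k : ℕ) (b : Bool) {n : ℕ} where
  open Merging k b

  -- The killed slot leaves the volume, and its deficit goes with it. The slack `α` is granted all
  -- the same, so that this branch has the budget of a merge and `up` and `low` need not know the
  -- kind of the edge.
  fits-kill : ∀ {ρ alive L β a i} t α → Fits L ρ alive β a → lookup alive zero ≡ false → lookup β zero ≡ [ 0ℤ ] →
    lookup alive i ≡ true → 0ℤ ∈ lookup β i → Fits {n} L (reroute i zero t ρ) (alive [ i ]≔ false) (mergeLists i zero t β) (a + α)
  fits-kill {ρ} {alive} {L} {β} {a} {i} t α f zero-dead β₀ i-live 0∈ = record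
    { deficit = d′
    ; deficit≤ = begin
        Vec.sum d′                     ≤⟨ m≤m+n _ (lookup deficit i) ⟩
        Vec.sum d′ + lookup deficit i  ≡⟨ sum-updateAt deficit i 0 ⟩
        Vec.sum deficit + 0            ≡⟨ +-identityʳ _ ⟩
        Vec.sum deficit                ≤⟨ deficit≤ ⟩
        a                              ≤⟨ m≤m+n a α ⟩
        a + α                          ∎
    ; slots = slots′
    ; contained = contained′
    }
    where
    open ≤-Reasoning
    open Fits f
    d′ = deficit [ i ]≔ 0
    alive′ = alive [ i ]≔ false
    β′ = mergeLists i zero t β
    zero≢i : zero ≢ i
    zero≢i refl with trans (sym i-live) zero-dead
    ... | ()
    β′₀ : lookup β′ zero ≡ lookup β zero
    β′₀ = trans (lookup∘updateAt zero (β [ i ]≔ [ 0ℤ ]))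
         (trans (cong (common t (lookup β i)) β₀) (trans (common-zero t 0∈) (sym β₀)))
    slots′ : Slots alive′ β′ d′
    slots′ l with l Fin.≟ i
    ... | yes refl rewrite lookup∘updateAt l {λ _ → false} alive | lookup∘updateAt l {λ _ → 0} deficit
                         | lookup∘updateAt′ l zero {λ _ → common t (lookup β l) (lookup β zero)} (zero≢i ∘ sym) (β [ l ]≔ [ 0ℤ ])
                         | lookup∘updateAt l {λ _ → [ 0ℤ ]} β = dead
    ... | no l≢i rewrite lookup∘updateAt′ l i {λ _ → false} l≢i alive | lookup∘updateAt′ l i {λ _ → 0} l≢i deficit with l Fin.≟ zero
    ...   | yes refl rewrite β′₀ = slots zero
    ...   | no l≢0 rewrite lookup∘updateAt′ l zero {λ _ → common t (lookup β i) (lookup β zero)} l≢0 (β [ i ]≔ [ 0ℤ ])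
                         | lookup∘updateAt′ l i {λ _ → [ 0ℤ ]} l≢i β = slots l
    contained′ : ∀ w → lookup alive′ (proj₁ (reroute i zero t ρ w)) ≡ true →
                 ∀ {y} → y ∈ lookup β′ (proj₁ (reroute i zero t ρ w)) → act (proj₂ (reroute i zero t ρ w)) y ∈ lookup L w
    contained′ w p {y} y∈ with proj₁ (ρ w) Fin.≟ i
    ... | yes _ with trans (sym p) (trans (lookup∘updateAt′ zero i zero≢i alive) zero-dead)
    ...   | ()
    contained′ w p {y} y∈ | no ≢i = contained w w-live
      (subst (y ∈_) (trans (lookup∘updateAt′ (proj₁ (ρ w)) zero ≢0 (β [ i ]≔ [ 0ℤ ])) (lookup∘updateAt′ (proj₁ (ρ w)) i ≢i β)) y∈)
      where
      w-live : lookup alive (proj₁ (ρ w)) ≡ true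
      w-live = trans (sym (lookup∘updateAt′ (proj₁ (ρ w)) i ≢i alive)) p
      ≢0 : proj₁ (ρ w) ≢ zero
      ≢0 eq with trans (sym w-live) (trans (cong (lookup alive) eq) zero-dead)
      ... | ()

  -- No list enters, so an edge has the same kind for both assignments and their recursions run in
  -- parallel.
  data Kind (ρ : Rep n) (alive : Vec Bool (suc n)) (e : Edge n) : Set where
    dependent : (∀ x → lookup x zero ≡ 0ℤ → Violates ρ x e) → Kind ρ alive e
    kill      : ∀ i t → lookup alive i ≡ true → Identifies ρ e i zero t → Kind ρ alive e
    merge     : let (u , v , _) = e; i = proj₁ (ρ u); j = proj₁ (ρ v) in
                i ≢ j → lookup alive i ≡ true → lookup alive j ≡ true → Kind ρ alive e

  kind : ∀ {ρ alive s} e → Shape ρ alive s → Kind ρ alive e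
  kind {ρ} {alive} (u , v , s) sh = go (Shape.used sh u) (Shape.used sh v)
    where
    i = proj₁ (ρ u)
    j = proj₁ (ρ v)
    s₁ = proj₂ (ρ u)
    s₂ = proj₂ (ρ v)
    at-zero : ∀ {l} → l ≡ zero → ∀ t (x : Vec ℤ (suc n)) → lookup x zero ≡ 0ℤ → act t (lookup x l) ≡ 0ℤ
    at-zero refl t x x₀ = trans (cong (act t) x₀) (act-0 t)
    go : i ≡ zero ⊎ lookup alive i ≡ true → j ≡ zero ⊎ lookup alive j ≡ true → Kind ρ alive (u , v , s)
    go (inj₁ i0) (inj₁ j0) = dependent λ x x₀ →
      trans (at-zero i0 s₁ x x₀) (sym (trans (cong (act s) (at-zero j0 s₂ x x₀)) (act-0 s)))
    go (inj₁ i0) (inj₂ j-live) = kill j pos j-live λ x x₀ → mk⇔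
      (λ p → trans (act≡0 s₂ (act≡0 s (trans (sym p) (at-zero i0 s₁ x x₀)))) (sym x₀))
      (λ p → trans (at-zero i0 s₁ x x₀) (sym (trans (cong (act s ∘ act s₂) (trans p x₀)) (trans (cong (act s) (act-0 s₂)) (act-0 s)))))
    go (inj₂ i-live) (inj₁ j0) = kill i pos i-live λ x x₀ → mk⇔
      (λ p → trans (act≡0 s₁ (trans p (trans (cong (act s) (at-zero j0 s₂ x x₀)) (act-0 s)))) (sym x₀))
      (λ p → trans (cong (act s₁) (trans p x₀)) (trans (act-0 s₁) (sym (trans (cong (act s) (at-zero j0 s₂ x x₀)) (act-0 s)))))
    go (inj₂ i-live) (inj₂ j-live) with i Fin.≟ j
    ... | no i≢j = merge i≢j i-live j-live
    ... | yes i≡j with same-slot s₁ s s₂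
    ...   | inj₁ h = dependent λ x _ → trans (h (lookup x i)) (cong (act s ∘ act s₂ ∘ lookup x) i≡j)
    ...   | inj₂ h = kill i pos i-live λ x x₀ → mk⇔
      (λ p → trans (h (lookup x i) (trans p (cong (act s ∘ act s₂ ∘ lookup x) (sym i≡j)))) (sym x₀))
      (λ p → trans (at-0 s₁ (trans p x₀)) (sym (trans (cong (act s) (at-0 s₂ (trans (cong (lookup x) (sym i≡j)) (trans p x₀)))) (act-0 s))))
      where
      at-0 : ∀ t {y} → y ≡ 0ℤ → act t y ≡ 0ℤ
      at-0 t refl = act-0 t

-- Comparing `L` with an assignment `K` free of deficits

module Comparison (k : ℕ) (b : Bool) (k>0 : 0 < k) {n : ℕ} (L K : Vec (List ℤ) n)
  (L-size : ∀ v → Unique (lookup L v) × length (lookup L v) ≡ k) (L-zero : ∀ v → HasZero b (lookup L v))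
  (K-size : ∀ v → Unique (lookup K v) × length (lookup K v) ≡ k) (K-zero : ∀ v → HasZero b (lookup K v))
  (K-common : ∀ s u v → k ≤ length (common s (lookup K u) (lookup K v)))
  (α : Edge n → ℕ) (L-common : ∀ u v s → length (common s (lookup L u) (lookup L v)) + α (u , v , s) ≡ k) where

  open Merging k b

  instance
    k≢0 : NonZero k
    k≢0 = >-nonZero k>0

  N : ℕ
  N = k ^ n

  -- up R a = ∑ k ^ |R ∖ T| (a + ∑_T α) over the subsets T of R of odd size;
  -- low is the same sum over the T of even size.
  up low : List (Edge n) → ℕ → ℕ
  up []      a = 0
  up (e ∷ R) a = k * up R a + low R (a + α e)
  low []      a = a
  low (e ∷ R) a = k * low R a + up R (a + α e)

  -- `scaleOf s (e ∷ R)` and `scaleOf (suc s) R` are both `k * scaleOf s R`, so the two branches at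
  -- `e` are measured on one scale. The `suc` absorbs the denominator `k` of the product inequality
  -- at a leaf.
  scaleOf : ℕ → List (Edge n) → ℕ
  scaleOf s R = k ^ (suc s + length R)

  -- Two-sided, since each bound at `e ∷ R` draws on the opposite bound for the contracted branch.
  Bounds : List (Edge n) → ℕ → ℕ → ℕ → ℕ → Set
  Bounds R s a p q = let E = scaleOf s R in E * p ≤ E * q + N * up R a × E * q ≤ E * p + N * low R a

  bounds-branch : ∀ {P p′ p Q q′ q s a} e R → P + p′ ≡ p → Q + q′ ≡ q →
    Bounds R s a p q → Bounds R (suc s) (a + α e) p′ q′ → Bounds (e ∷ R) s a P Q
  bounds-branch {P} {p′} {p} {Q} {q′} {q} {s} {a} e R eq eq′ (h₁ , h₂) (h₁′ , h₂′) rewrite +-suc s (length R) =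
    branch-≤₀ E k N (up R a) (low R (a + α e)) eq eq′ h₁ h₂′ ,
    branch-≤₀ E k N (low R a) (up R (a + α e)) eq′ eq h₂ h₁′
    where E = scaleOf s R

  -- Without edges both counts are products of list sizes. Deficit 0 makes the product for `K` the
  -- full volume; the one for `L` is at most that, and at least what the product inequality allows.
  leaf : ∀ {ρ alive s β γ a} → Shape ρ alive s → Fits L ρ alive β a → Fits K ρ alive γ 0 →
         Bounds [] s a (count ρ β []) (count ρ γ [])
  leaf {ρ} {alive} {s} {β} {γ} {a} sh fL fK rewrite sumV-1 β | sumV-1 γ | +-identityʳ s =
    ≤-trans (*-monoʳ-≤ (k ^ suc s) (≤-trans p≤V V≤q)) (m≤m+n _ _) ,
    (begin
      k * k ^ s * sizes γ                          ≤⟨ *-monoʳ-≤ (k * k ^ s) q≤V ⟩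
      k * k ^ s * V                                ≡⟨ lem₁ k (k ^ s) V ⟩
      k ^ s * (k * V)                              ≤⟨ *-monoʳ-≤ (k ^ s) (volume≤sizes alive β (deficit fL) (slots fL)) ⟩
      k ^ s * (k * sizes β + V * Vec.sum (deficit fL))  ≤⟨ *-monoʳ-≤ (k ^ s) (+-monoʳ-≤ (k * sizes β) (*-monoʳ-≤ V (deficit≤ fL))) ⟩
      k ^ s * (k * sizes β + V * a)                ≡⟨ lem₂ k (k ^ s) V (sizes β) a ⟩
      k * k ^ s * sizes β + k ^ s * V * a          ≡⟨ cong (λ z → k * k ^ s * sizes β + z * a) (Shape.scaled sh) ⟩
      k * k ^ s * sizes β + N * a                  ∎)
    where
    open ≤-Reasoning
    open Fits
    V = volume alive
    lem₁ : ∀ k x v → k * x * v ≡ x * (k * v)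
    lem₁ = solve-∀
    lem₂ : ∀ k x v s a → x * (k * s + v * a) ≡ k * x * s + x * v * a
    lem₂ = solve-∀
    p≤V : sizes β ≤ V
    p≤V = sizes≤volume alive β (deficit fL) (slots fL)
    q≤V : sizes γ ≤ V
    q≤V = sizes≤volume alive γ (deficit fK) (slots fK)
    V≤q : V ≤ sizes γ
    V≤q = *-cancelˡ-≤ k (begin
      k * V                                      ≤⟨ volume≤sizes alive γ (deficit fK) (slots fK) ⟩
      k * sizes γ + V * Vec.sum (deficit fK)     ≡⟨ cong (λ z → k * sizes γ + V * z) (n≤0⇒n≡0 (deficit≤ fK)) ⟩
      k * sizes γ + V * 0                        ≡⟨ cong (λ z → k * sizes γ + z) (*-zeroʳ V) ⟩
      k * sizes γ + 0                            ≡⟨ +-identityʳ _ ⟩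
      k * sizes γ                                ∎)

  split-branch : ∀ {ρ : Rep n} {β e i j t} R → Unique (lookup β i) → i ≢ j → lookup β zero ≡ [ 0ℤ ] → Identifies ρ e i j t →
    count ρ β (e ∷ R) + count (reroute i j t ρ) (mergeLists i j t β) R ≡ count ρ β R
  split-branch {ρ} {β} {e} {i} {j} {t} R u i≢j β₀ ident =
    trans (cong (λ z → count ρ β (e ∷ R) + z) (sym (countViolating-merge {ρ = ρ} {β} {e} {i} {j} {t} R u i≢j β₀ ident)))
          (count-split ρ β e R)

  merge-step : ∀ {ρ : Rep n} {alive s β γ a} (e : Edge n) → let (u , v , σ) = e; i = proj₁ (ρ u); j = proj₁ (ρ v); t = proj₂ (ρ u) · σ · proj₂ (ρ v) in
    Shape ρ alive s → Fits L ρ alive β a → Fits K ρ alive γ 0 →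
    i ≢ j → lookup alive i ≡ true → lookup alive j ≡ true →
    Shape (reroute i j t ρ) (alive [ i ]≔ false) (suc s) ×
    Fits L (reroute i j t ρ) (alive [ i ]≔ false) (mergeLists i j t β) (a + α e) ×
    Fits K (reroute i j t ρ) (alive [ i ]≔ false) (mergeLists i j t γ) 0 ×
    (∀ R → count ρ β (e ∷ R) + count (reroute i j t ρ) (mergeLists i j t β) R ≡ count ρ β R) ×
    (∀ R → count ρ γ (e ∷ R) + count (reroute i j t ρ) (mergeLists i j t γ) R ≡ count ρ γ R)
  merge-step {ρ} {alive} {s} {β} {γ} {a} e@(u , v , σ) sh fL fK i≢j i-live j-live =
    shape-merge _ sh i-live i≢j (inj₂ j-live) ,
    fits-merge e fL L-size i≢j i-live j-live (≤-reflexive (sym (L-common u v σ))) ,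
    fits-merge e fK K-size i≢j i-live j-live (≤-trans (K-common σ u v) (m≤m+n _ 0)) ,
    (λ R → split-branch {ρ} {β} {e} R (live-unique _ fL i-live) i≢j (zero-list sh fL) (identifies-merge ρ e)) ,
    (λ R → split-branch {ρ} {γ} {e} R (live-unique _ fK i-live) i≢j (zero-list sh fK) (identifies-merge ρ e))

  box-zero : ∀ {β : Vec (List ℤ) (suc n)} {x} → lookup β zero ≡ [ 0ℤ ] → InBox β x → lookup x zero ≡ 0ℤ
  box-zero {x = x} β₀ x∈ with subst (lookup x zero ∈_) β₀ (x∈ zero)
  ... | here p = p

  count-kill-0 : ∀ {ρ : Rep n} {β i} R t → lookup β zero ≡ [ 0ℤ ] → 0ℤ ∉ lookup β i → count ρ (mergeLists i zero t β) R ≡ 0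
  count-kill-0 {ρ} {β} {i} R t β₀ 0∉ = sumV-empty (mergeLists i zero t β) zero (proper ρ R)
    (trans (lookup∘updateAt zero (β [ i ]≔ [ 0ℤ ])) (trans (cong (common t (lookup β i)) β₀) (common-zero-∉ t 0∉)))

  bounds : ∀ R {ρ alive s β γ a} → Shape ρ alive s → Fits L ρ alive β a → Fits K ρ alive γ 0 →
           Bounds R s a (count ρ β R) (count ρ γ R)
  -- If 0 is a colour everywhere, this is a merge into slot zero. If it is a colour nowhere, the
  -- contracted counts are 0 for both assignments and cannot separate them.
  bounds-kill : ∀ c → c ≡ b → ∀ e R {ρ alive s β γ a i t} → Shape ρ alive s → Fits L ρ alive β a → Fits K ρ alive γ 0 →
    lookup alive i ≡ true → Identifies ρ e i zero t → Bounds (e ∷ R) s a (count ρ β (e ∷ R)) (count ρ γ (e ∷ R))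

  bounds []      sh fL fK = leaf sh fL fK
  bounds (e ∷ R) {ρ} {alive} {s} {β} {γ} {a} sh fL fK with kind k b e sh
  -- No colouring is proper on such an edge, so both counts are 0.
  ... | dependent h rewrite count-always-violated ρ β e R (λ x x∈ → h x (box-zero {β} {x} (zero-list sh fL) x∈))
                          | count-always-violated ρ γ e R (λ x x∈ → h x (box-zero {γ} {x} (zero-list sh fK) x∈))
                          | *-zeroʳ (scaleOf s (e ∷ R)) = z≤n , z≤n
  ... | kill i t i-live ident = bounds-kill b refl e R {t = t} sh fL fK i-live ident
  ... | merge i≢j i-live j-live = bounds-branch {s = s} e R (eqL R) (eqK R) (bounds R sh fL fK) (bounds R sh′ fL′ fK′)
    where
    next = merge-step {ρ} {alive} {s} {β} {γ} {a} e sh fL fK i≢j i-live j-live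
    sh′ = proj₁ next
    fL′ = proj₁ (proj₂ next)
    fK′ = proj₁ (proj₂ (proj₂ next))
    eqL = proj₁ (proj₂ (proj₂ (proj₂ next)))
    eqK = proj₂ (proj₂ (proj₂ (proj₂ next)))

  bounds-kill true refl e R {ρ} {alive} {s} {β} {γ} {a} {i} {t} sh fL fK i-live ident =
    bounds-branch {s = s} e R
      (split-branch {ρ} {β} {e} {i} {zero} {t} R (live-unique i fL i-live) i≢0 (zero-list sh fL) ident)
      (split-branch {ρ} {γ} {e} {i} {zero} {t} R (live-unique i fK i-live) i≢0 (zero-list sh fK) ident)
      (bounds R sh fL fK)
      (bounds R (shape-merge t sh i-live i≢0 (inj₁ refl))
        (fits-kill k b t (α e) fL (Shape.zero-dead sh) (zero-list sh fL) i-live (live-HasZero i fL i-live))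
        (fits-kill k b t 0 fK (Shape.zero-dead sh) (zero-list sh fK) i-live (live-HasZero i fK i-live)))
    where
    i≢0 : i ≢ zero
    i≢0 refl with trans (sym i-live) (Shape.zero-dead sh)
    ... | ()
  bounds-kill false refl e R {ρ} {alive} {s} {β} {γ} {a} {i} {t} sh fL fK i-live ident =
    bounds-branch {s = s} e R (eq fL) (eq fK) (bounds R sh fL fK)
      (subst₂ (λ x y → Bounds R (suc s) (a + α e) x y) (sym (vanish fL)) (sym (vanish fK)) (zeros (scaleOf (suc s) R) _ , zeros (scaleOf (suc s) R) _))
    where
    i≢0 : i ≢ zero
    i≢0 refl with trans (sym i-live) (Shape.zero-dead sh)
    ... | ()
    zeros : ∀ E x → E * 0 ≤ E * 0 + x
    zeros E x = m≤m+n (E * 0) x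
    vanish : ∀ {L β a} → Fits L ρ alive β a → count (reroute i zero t ρ) (mergeLists i zero t β) R ≡ 0
    vanish {β = β} f = count-kill-0 {reroute i zero t ρ} {β} {i} R t (zero-list sh f) (live-HasZero i f i-live)
    eq : ∀ {L β a} → Fits L ρ alive β a → count ρ β (e ∷ R) + count (reroute i zero t ρ) (mergeLists i zero t β) R ≡ count ρ β R
    eq {β = β} f = split-branch {ρ} {β} {e} {i} {zero} {t} R (live-unique i f i-live) i≢0 (zero-list sh f) ident

  ρ₀ : Rep n
  ρ₀ v = suc v , pos

  alive₀ : Vec Bool (suc n)
  alive₀ = false ∷ replicate n true

  β₀ γ₀ : Vec (List ℤ) (suc n)
  β₀ = [ 0ℤ ] ∷ L
  γ₀ = [ 0ℤ ] ∷ K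

  shape₀ : Shape ρ₀ alive₀ 0
  shape₀ = record
    { zero-dead = refl
    ; used = λ v → inj₂ (lookup-replicate v true)
    ; scaled = trans (+-identityʳ _) (volume-replicate n)
    }
    where
    volume-replicate : ∀ m → volume (replicate m true) ≡ k ^ m
    volume-replicate zero    = refl
    volume-replicate (suc m) = cong (k *_) (volume-replicate m)

  fits₀ : ∀ (X : Vec (List ℤ) n) → (∀ v → Unique (lookup X v) × length (lookup X v) ≡ k) → (∀ v → HasZero b (lookup X v)) →
          Fits X ρ₀ alive₀ ([ 0ℤ ] ∷ X) 0
  fits₀ X X-size X-zero = record
    { deficit = replicate (suc n) 0
    ; deficit≤ = ≤-reflexive (sum-replicate n)
    ; slots = slots
    ; contained = λ v _ y∈ → y∈
    }
    where
    sum-replicate : ∀ m → Vec.sum (replicate m 0) ≡ 0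
    sum-replicate zero    = refl
    sum-replicate (suc m) = sum-replicate m
    slots : Slots alive₀ ([ 0ℤ ] ∷ X) (replicate (suc n) 0)
    slots zero = dead
    slots (suc v) rewrite lookup-replicate {n = n} v true | lookup-replicate {n = n} v 0 =
      live (proj₁ (X-size v)) (X-zero v) (≤-reflexive (proj₂ (X-size v)))
           (≤-reflexive (trans (sym (proj₂ (X-size v))) (sym (+-identityʳ _))))

  -- An exact value where `leaf` has only bounds: the advantage of `L` over `K` comes from the sets
  -- of one violated edge, and an upper bound by the volume would discard it. The factor
  -- `k * (k * 1)` is `scaleOf 1 []`.
  sizes-merged : ∀ (X : Vec (List ℤ) n) → (∀ v → Unique (lookup X v) × length (lookup X v) ≡ k) → ∀ {u v} t → u ≢ v →
    k * (k * 1) * sizes (mergeLists (suc u) (suc v) t ([ 0ℤ ] ∷ X)) ≡ N * length (common t (lookup X u) (lookup X v))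
  sizes-merged X X-size {u} {v} t u≢v = begin
    k * (k * 1) * sizes β″            ≡⟨ lem k (sizes β″) ⟩
    sizes β″ * k * k                  ≡⟨ cong (_* k) (trans (cong (sizes β″ *_) (sym len-v)) (sizes-updateAt β′ (suc v) C)) ⟩
    sizes β′ * length C * k           ≡⟨ lem′ (sizes β′) (length C) k ⟩
    sizes β′ * k * length C           ≡⟨ cong (_* length C) (trans (cong (sizes β′ *_) (sym (proj₂ (X-size u)))) (sizes-updateAt β (suc u) [ 0ℤ ])) ⟩
    sizes β * 1 * length C            ≡⟨ cong (_* length C) (trans (*-identityʳ _) (trans (+-identityʳ _) (sizes-const X (proj₂ ∘ X-size)))) ⟩
    N * length C                      ∎
    where
    open ≡-Reasoning
    β = [ 0ℤ ] ∷ X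
    C = common t (lookup X u) (lookup X v)
    β′ = β [ suc u ]≔ [ 0ℤ ]
    β″ = β′ [ suc v ]≔ C
    len-v : length (lookup β′ (suc v)) ≡ k
    len-v = trans (cong length (lookup∘updateAt′ v u (u≢v ∘ sym) X)) (proj₂ (X-size v))
    lem : ∀ k x → k * (k * 1) * x ≡ x * k * k
    lem = solve-∀
    lem′ : ∀ x y z → x * y * z ≡ x * z * y
    lem′ = solve-∀
    sizes-const : ∀ {m} (Y : Vec (List ℤ) m) → (∀ v → length (lookup Y v) ≡ k) → sizes Y ≡ k ^ m
    sizes-const []      _ = refl
    sizes-const (l ∷ Y) h = cong₂ _*_ (h zero) (sizes-const Y (h ∘ suc))

  NonParallel : Edge n → Edge n → Set
  NonParallel e f = ¬ SamePair e f

  module Single (e : Edge n) (e-notLoop : NotLoop e) where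
    u = proj₁ e
    v = proj₁ (proj₂ e)
    σ = proj₂ (proj₂ e)
    t = pos · σ · pos
    ρ₁ = reroute (suc u) (suc v) t ρ₀
    alive₁ = alive₀ [ suc u ]≔ false
    β₁ = mergeLists (suc u) (suc v) t β₀
    γ₁ = mergeLists (suc u) (suc v) t γ₀

    first = merge-step e shape₀ (fits₀ L L-size L-zero) (fits₀ K K-size K-zero) (e-notLoop ∘ Fin.suc-injective)
              (lookup-replicate u true) (lookup-replicate v true)
    sh₁ : Shape ρ₁ alive₁ 1
    sh₁ = proj₁ first
    fL₁ : Fits L ρ₁ alive₁ β₁ (α e)
    fL₁ = proj₁ (proj₂ first)
    fK₁ : Fits K ρ₁ alive₁ γ₁ 0
    fK₁ = proj₁ (proj₂ (proj₂ first))
    splitL : ∀ R → count ρ₀ β₀ (e ∷ R) + count ρ₁ β₁ R ≡ count ρ₀ β₀ R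
    splitL = proj₁ (proj₂ (proj₂ (proj₂ first)))
    splitK : ∀ R → count ρ₀ γ₀ (e ∷ R) + count ρ₁ γ₁ R ≡ count ρ₀ γ₀ R
    splitK = proj₂ (proj₂ (proj₂ (proj₂ first)))

    slot₁ : ∀ x → (x ≡ u × proj₁ (ρ₁ x) ≡ suc v) ⊎ proj₁ (ρ₁ x) ≡ suc x
    slot₁ x with suc x Fin.≟ suc u
    ... | yes p = inj₁ (Fin.suc-injective p , refl)
    ... | no  _ = inj₂ refl

    slot₁-live : ∀ x → lookup alive₁ (proj₁ (ρ₁ x)) ≡ true
    slot₁-live x with Shape.used sh₁ x
    ... | inj₂ p = p
    ... | inj₁ p with slot₁ x
    ...   | inj₁ (_ , q) = contradiction (trans (sym p) q) λ ()
    ...   | inj₂ q       = contradiction (trans (sym p) q) λ ()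

    -- Here simplicity of the graph enters. After contracting `e` alone, every other edge still
    -- joins distinct live slots, so it is a merge and never a dependent edge, which would wipe out
    -- the gain from `e`.
    slots₁-distinct : ∀ f → NotLoop f → NonParallel e f → proj₁ (ρ₁ (proj₁ f)) ≢ proj₁ (ρ₁ (proj₁ (proj₂ f)))
    slots₁-distinct (x , y , _) x≢y ¬par eq with slot₁ x | slot₁ y
    ... | inj₁ (x≡u , _) | inj₁ (y≡u , _) = x≢y (trans x≡u (sym y≡u))
    ... | inj₁ (x≡u , p) | inj₂ q         = ¬par (inj₁ (sym x≡u , Fin.suc-injective (trans (sym p) (trans eq q))))
    ... | inj₂ p         | inj₁ (y≡u , q) = ¬par (inj₂ (sym y≡u , Fin.suc-injective (sym (trans (sym p) (trans eq q)))))
    ... | inj₂ p         | inj₂ q         = x≢y (Fin.suc-injective (trans (sym p) (trans eq q)))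

    t≡σ : t ≡ σ
    t≡σ with σ
    ... | pos = refl
    ... | neg = refl

    -- The gain arises at the end of the list, where `e` is the only violated edge, and deletion of
    -- each further edge multiplies it by `k`. Contracting a second edge leads to `bounds`.
    single-bound : ∀ R → All NotLoop R → All (NonParallel e) R →
      scaleOf 1 R * count ρ₁ β₁ R + N * (k ^ length R * α e) ≤ scaleOf 1 R * count ρ₁ γ₁ R + N * up R (α e)
    single-bound [] _ _ rewrite sumV-1 β₁ | sumV-1 γ₁ = begin
      k * (k * 1) * sizes β₁ + N * (1 * α e)
        ≡⟨ cong₂ _+_ (trans (sizes-merged L L-size t e-notLoop) (cong (λ τ → N * length (common τ (lookup L u) (lookup L v))) t≡σ))
                     (cong (N *_) (+-identityʳ (α e))) ⟩
      N * length (common σ (lookup L u) (lookup L v)) + N * α e  ≡⟨ *-distribˡ-+ N _ (α e) ⟨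
      N * (length (common σ (lookup L u) (lookup L v)) + α e)    ≡⟨ cong (N *_) (L-common u v σ) ⟩
      N * k                                                      ≤⟨ *-monoʳ-≤ N (K-common t u v) ⟩
      N * length (common t (lookup K u) (lookup K v))            ≡⟨ sizes-merged K K-size t e-notLoop ⟨
      k * (k * 1) * sizes γ₁                                     ≤⟨ m≤m+n _ (N * 0) ⟩
      k * (k * 1) * sizes γ₁ + N * 0                             ∎
      where open ≤-Reasoning
    single-bound (f ∷ R) (f-notLoop ∷ nl) (¬par ∷ np) = begin
      k * E * count ρ₁ β₁ (f ∷ R) + N * (k * k ^ length R * α e)
        ≡⟨ cong (λ z → k * E * count ρ₁ β₁ (f ∷ R) + z) (lem N k (k ^ length R) (α e)) ⟩
      k * E * count ρ₁ β₁ (f ∷ R) + (k * (N * (k ^ length R * α e)) + 0)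
        ≤⟨ branch-≤ E k N (up R (α e)) (low R (α e + α f)) _ 0 (eqL R) (eqK R) (single-bound R nl np)
             (≤-trans (≤-reflexive (+-identityʳ _)) (proj₂ (bounds R sh₂ fL₂ fK₂))) ⟩
      k * E * count ρ₁ γ₁ (f ∷ R) + N * up (f ∷ R) (α e) ∎
      where
      open ≤-Reasoning
      E = scaleOf 1 R
      lem : ∀ N k x a → N * (k * x * a) ≡ k * (N * (x * a)) + 0
      lem = solve-∀
      next = merge-step f sh₁ fL₁ fK₁ (slots₁-distinct f f-notLoop ¬par) (slot₁-live (proj₁ f)) (slot₁-live (proj₁ (proj₂ f)))
      sh₂ = proj₁ next
      fL₂ = proj₁ (proj₂ next)
      fK₂ = proj₁ (proj₂ (proj₂ next))
      eqL = proj₁ (proj₂ (proj₂ (proj₂ next)))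
      eqK = proj₂ (proj₂ (proj₂ (proj₂ next)))

  -- `gain` collects the one-element sets and `loss` the nonempty even ones. An even set is its
  -- first edge `e` together with an odd subset of the later edges, hence `up R (α e)`.
  gain loss : List (Edge n) → ℕ
  gain []      = 0
  gain (e ∷ R) = k * gain R + k ^ length R * α e
  loss []      = 0
  loss (e ∷ R) = k * loss R + up R (α e)

  total-bound : ∀ R → All NotLoop R → AllPairs NonParallel R →
    scaleOf 0 R * count ρ₀ γ₀ R + N * gain R ≤ scaleOf 0 R * count ρ₀ β₀ R + N * loss R
  total-bound [] _ _ = begin
    scaleOf 0 [] * count ρ₀ γ₀ [] + N * 0    ≤⟨ +-monoˡ-≤ (N * 0) (proj₂ (leaf shape₀ (fits₀ L L-size L-zero) (fits₀ K K-size K-zero))) ⟩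
    scaleOf 0 [] * count ρ₀ β₀ [] + N * 0 + N * 0   ≡⟨ lem _ N ⟩
    scaleOf 0 [] * count ρ₀ β₀ [] + N * 0 ∎
    where
    open ≤-Reasoning
    lem : ∀ x N → x + N * 0 + N * 0 ≡ x + N * 0
    lem = solve-∀
  total-bound (e ∷ R) (nl ∷ nls) (np ∷ nps) = begin
    k * E * count ρ₀ γ₀ (e ∷ R) + N * gain (e ∷ R)
      ≡⟨ cong (λ z → k * E * count ρ₀ γ₀ (e ∷ R) + z) (lem N k (gain R) (k ^ length R * α e)) ⟩
    k * E * count ρ₀ γ₀ (e ∷ R) + (k * (N * gain R) + N * (k ^ length R * α e))
      ≤⟨ branch-≤ E k N (loss R) (up R (α e)) (N * gain R) (N * (k ^ length R * α e)) (splitK R) (splitL R)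
           (total-bound R nls nps) (single-bound R nls np) ⟩
    k * E * count ρ₀ β₀ (e ∷ R) + N * loss (e ∷ R) ∎
    where
    open ≤-Reasoning
    open Single e nl
    E = scaleOf 0 R
    lem : ∀ N k g x → N * (k * g + x) ≡ k * (N * g) + N * x
    lem = solve-∀

  even-part odd-part : ℕ → ℕ
  even-part r = proj₁ (pow r (k , 1))
  odd-part  r = proj₂ (pow r (k , 1))

  totalα : List (Edge n) → ℕ
  totalα []      = 0
  totalα (e ∷ R) = α e + totalα R

  -- Double counting: `a` occurs once for every odd subset of the `suc r` edges, and the `α` of an
  -- edge once for every even subset of the other `r`. Expanding `(k + j)^r` sums the weights of
  -- even and odd subsets.
  up-closed  : ∀ e R a → let r = length R in up  (e ∷ R) a ≡ a * odd-part (suc r) + totalα (e ∷ R) * even-part r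
  low-closed : ∀ e R a → let r = length R in low (e ∷ R) a ≡ a * even-part (suc r) + totalα (e ∷ R) * odd-part r
  up-closed e [] a = lem k a (α e)
    where
    lem : ∀ k a x → k * 0 + (a + x) ≡ a * (k * 0 + 1 * 1) + (x + 0) * 1
    lem = solve-∀
  up-closed e (f ∷ R) a rewrite up-closed f R a | low-closed f R (a + α e) =
    lem k a (α e) (totalα (f ∷ R)) (even-part (length R)) (odd-part (length R))
    where
    lem : ∀ k a x A c s → k * (a * (k * s + 1 * c) + A * c) + ((a + x) * (k * c + 1 * s) + A * s)
        ≡ a * (k * (k * s + 1 * c) + 1 * (k * c + 1 * s)) + (x + A) * (k * c + 1 * s)
    lem = solve-∀
  low-closed e [] a = lem k a (α e)
    where
    lem : ∀ k a x → k * a + 0 ≡ a * (k * 1 + 1 * 0) + (x + 0) * 0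
    lem = solve-∀
  low-closed e (f ∷ R) a rewrite low-closed f R a | up-closed f R (a + α e) =
    lem k a (α e) (totalα (f ∷ R)) (even-part (length R)) (odd-part (length R))
    where
    lem : ∀ k a x A c s → k * (a * (k * c + 1 * s) + A * s) + ((a + x) * (k * s + 1 * c) + A * c)
        ≡ a * (k * (k * c + 1 * s) + 1 * (k * s + 1 * c)) + (x + A) * (k * s + 1 * c)
    lem = solve-∀

  -- An edge lies in an even set once for every odd subset of the remaining edges.
  loss-closed : ∀ e R → loss (e ∷ R) ≡ odd-part (length R) * totalα (e ∷ R)
  loss-closed e []      = trans (+-identityʳ _) (*-zeroʳ k)
  loss-closed e (f ∷ R) rewrite loss-closed f R | up-closed f R (α e) =
    lem k (α e) (totalα (f ∷ R)) (even-part (length R)) (odd-part (length R))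
    where
    lem : ∀ k x A c s → k * (s * A) + (x * (k * s + 1 * c) + A * c) ≡ (k * s + 1 * c) * (x + A)
    lem = solve-∀

  gain-closed : ∀ e R → gain (e ∷ R) ≡ k ^ length R * totalα (e ∷ R)
  gain-closed e [] = lem k (α e)
    where
    lem : ∀ k x → k * 0 + 1 * x ≡ 1 * (x + 0)
    lem = solve-∀
  gain-closed e (f ∷ R) rewrite gain-closed f R = lem k (k ^ length R) (α e) (totalα (f ∷ R))
    where
    lem : ∀ k y x A → k * (y * A) + k * y * x ≡ k * y * (x + A)
    lem = solve-∀

  comparison : ∀ R → All NotLoop R → AllPairs NonParallel R → odd-part (length R ∸ 1) < k ^ (length R ∸ 1) →
    count ρ₀ γ₀ R ≤ count ρ₀ β₀ R × (count ρ₀ β₀ R ≡ count ρ₀ γ₀ R → totalα R ≡ 0)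
  comparison [] nl np _ = *-cancelˡ-≤ (k ^ 1) {{m^n≢0 k 1}} (+-cancelʳ-≤ (N * 0) _ _ (total-bound [] nl np)) , λ _ → refl
  comparison (e ∷ R) nl np small = larger , equal
    where
    r = length R
    A = totalα (e ∷ R)
    E = scaleOf 0 (e ∷ R)
    open ≤-Reasoning
    instance
      E≢0 : NonZero E
      E≢0 = m^n≢0 k (suc (suc r))
      N≢0 : NonZero N
      N≢0 = m^n≢0 k n
    bound : E * count ρ₀ γ₀ (e ∷ R) + N * (k ^ r * A) ≤ E * count ρ₀ β₀ (e ∷ R) + N * (odd-part r * A)
    bound = subst₂ (λ g l → E * count ρ₀ γ₀ (e ∷ R) + N * g ≤ E * count ρ₀ β₀ (e ∷ R) + N * l)
              (gain-closed e R) (loss-closed e R) (total-bound (e ∷ R) nl np)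
    larger : count ρ₀ γ₀ (e ∷ R) ≤ count ρ₀ β₀ (e ∷ R)
    larger = *-cancelˡ-≤ E (+-cancelʳ-≤ (N * (k ^ r * A)) _ _
      (≤-trans bound (+-monoʳ-≤ (E * count ρ₀ β₀ (e ∷ R)) (*-monoʳ-≤ N (*-monoˡ-≤ A (<⇒≤ small))))))
    equal : count ρ₀ β₀ (e ∷ R) ≡ count ρ₀ γ₀ (e ∷ R) → A ≡ 0
    equal eq with A ≟ 0
    ... | yes A≡0 = A≡0
    -- Equal counts cancel from `bound` and leave `k ^ r * A ≤ odd-part r * A`.
    ... | no  A≢0 = contradiction
      (*-cancelˡ-≤ N (+-cancelˡ-≤ (E * count ρ₀ γ₀ (e ∷ R)) _ _
        (subst (λ z → E * count ρ₀ γ₀ (e ∷ R) + N * (k ^ r * A) ≤ E * z + N * (odd-part r * A)) eq bound)))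
      (<⇒≱ (*-monoˡ-< A {{≢-nonZero A≢0}} small))

-- Signed graphs

M-length : ∀ k → length (M k) ≡ k
M-length zero          = refl
M-length (suc zero)    = refl
M-length (suc (suc k)) = cong (λ m → suc (suc m)) (M-length k)

M-neg : ∀ k {x} → x ∈ M k → - x ∈ M k
M-neg (suc zero)    (here refl)         = here refl
M-neg (suc (suc k)) (here refl)         = there (here refl)
M-neg (suc (suc k)) (there (here refl)) = here refl
M-neg (suc (suc k)) (there (there p))   = there (there (M-neg k p))

M-act : ∀ k s {x} → x ∈ M k → act s x ∈ M k
M-act k pos p = p
M-act k neg p = M-neg k p

M-bound : ∀ k {x} → x ∈ M k → ℤ.∣ x ∣ ≤ ⌊ k /2⌋
M-bound (suc zero)    (here refl)         = z≤n
M-bound (suc (suc k)) (here refl)         = ≤-refl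
M-bound (suc (suc k)) (there (here refl)) = ≤-refl
M-bound (suc (suc k)) (there (there p))   = m≤n⇒m≤1+n (M-bound k p)

M-unique : ∀ k → Unique (M k)
M-unique zero          = []
M-unique (suc zero)    = [] ∷ []
M-unique (suc (suc k)) = ((λ ()) ∷ fresh refl) ∷ fresh refl ∷ M-unique k
  where
  -- The two new colours exceed all of `M k` in absolute value.
  fresh : ∀ {x} → ℤ.∣ x ∣ ≡ suc ⌊ k /2⌋ → All (x ≢_) (M k)
  fresh |x| = All.tabulate λ { y∈ refl → 1+n≰n (subst (_≤ ⌊ k /2⌋) |x| (M-bound k y∈)) }

M-even : ∀ t → 0ℤ ∉ M (2 * t)
M-even (suc t) rewrite +-suc t (t + 0) = λ { (there (there p)) → M-even t p }

M-odd : ∀ t → 0ℤ ∈ M (suc (2 * t))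
M-odd zero = here refl
M-odd (suc t) rewrite +-suc t (t + 0) = there (there (M-odd t))

common-M : ∀ k s → length (common s (M k) (M k)) ≡ k
common-M k s = trans (cong length (filter-all (λ z → act s z ∈? M k) {xs = M k} (All.tabulate (M-act k s)))) (M-length k)

lookup-constAssign : ∀ m l v → lookup (constAssign m l) v ≡ l
lookup-constAssign (suc m) l zero    = refl
lookup-constAssign (suc m) l (suc v) = lookup-constAssign m l v

proper-properᵇ : ∀ {n} (c : Vec ℤ n) (p : Edge n → Bool) →
  (∀ u v s → p (u , v , s) ≡ not (does (lookup c u ℤ.≟ act s (lookup c v)))) →
  ∀ R → (if all p R then 1 else 0) ≡ proper (λ v → suc v , pos) R (0ℤ ∷ c)
proper-properᵇ c p h [] = refl
proper-properᵇ c p h ((u , v , s) ∷ R) rewrite h u v s with lookup c u ℤ.≟ act s (lookup c v)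
... | yes _ = refl
... | no  _ = proper-properᵇ c p h R

PL-count : ∀ S L → PL S L ≡ count (λ v → suc v , pos) ([ 0ℤ ] ∷ L) (edges S)
PL-count S L = trans (sum-choices L _) (trans (sumV-cong L pointwise) (sym (+-identityʳ _)))
  where
  pointwise : ∀ c → (if properᵇ S c then 1 else 0) ≡ proper (λ v → suc v , pos) (edges S) (0ℤ ∷ c)
  pointwise c = proper-properᵇ c _ (λ u v s → cong (λ z → not (does (lookup c u ℤ.≟ z))) (⟦⟧-act s (lookup c v))) (edges S)

unique-⊆-reverse : ∀ {xs ys : List ℤ} → Unique xs → (∀ {a} → a ∈ xs → a ∈ ys) → length ys ≤ length xs →
                   ∀ {a} → a ∈ ys → a ∈ xs
unique-⊆-reverse {xs} {ys} u sub le {a} a∈ with a ∈? xs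
... | yes p = p
... | no  p = contradiction (≤-trans (unique-⊆-length (All.¬Any⇒All¬ xs p ∷ u) λ { (here refl) → a∈ ; (there q) → sub q }) le) 1+n≰n

scale-act : ∀ s A → scale s A ≡ map (act s) A
scale-act s []      = refl
scale-act s (x ∷ A) = cong₂ _∷_ (⟦⟧-act s x) (scale-act s A)

-- A full common list only says that `s` carries `B` into `A`; equal sizes supply the converse.
common-full : ∀ {k A B} s → Unique B → length A ≡ k → length B ≡ k → length (common s A B) ≡ k → SetEq B (scale s A)
common-full {k} {A} {B} s uB |A| |B| |C| x = fwd , bwd
  where
  full : common s A B ≡ B
  full = filter-complete (λ z → act s z ∈? A) (trans |C| (sym |B|))
  B→A : ∀ {z} → z ∈ B → act s z ∈ A
  B→A z∈ = proj₂ (∈-filter⁻ (λ z → act s z ∈? A) {xs = B} (subst (_ ∈_) (sym full) z∈))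
  sB⊆A : ∀ {a} → a ∈ map (act s) B → a ∈ A
  sB⊆A a∈ with ∈-map⁻ (act s) a∈
  ... | z , z∈ , refl = B→A z∈
  fwd : x ∈ B → x ∈ scale s A
  fwd x∈ rewrite scale-act s A = subst (_∈ map (act s) A) (act-involutive s x) (∈-map⁺ (act s) (B→A x∈))
  bwd : x ∈ scale s A → x ∈ B
  bwd x∈ rewrite scale-act s A with ∈-map⁻ (act s) x∈
  ... | y , y∈ , refl with ∈-map⁻ (act s) (unique-⊆-reverse (unique-map-act s uB) sB⊆A
                             (≤-reflexive (trans |A| (trans (sym |B|) (sym (length-map (act s) B))))) y∈)
  ... | z , z∈ , refl = subst (_∈ B) (sym (act-involutive s z)) z∈

-- Compatible lists along walks and unbalanced cycles

module Components (S : SignedGraph) (L : ListAssignment S) (compatible : EdgeCompatible S L) where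

  Agree : Sign → Fin (n S) → Fin (n S) → Set
  Agree s u v = ∀ x → x ∈ lookup L u → act s x ∈ lookup L v

  adj-agree : ∀ {u v s} → Adj S u v s → Agree s u v
  adj-agree {u} {v} {s} (inj₂ e∈) x x∈ with subst (x ∈_) (scale-act s _) (proj₁ (All.lookup compatible e∈ x) x∈)
  ... | p with ∈-map⁻ (act s) p
  ... | y , y∈ , refl = subst (_∈ lookup L v) (sym (act-involutive s y)) y∈
  adj-agree {u} {v} {s} (inj₁ e∈) x x∈ = proj₂ (All.lookup compatible e∈ (act s x))
    (subst (act s x ∈_) (sym (scale-act s _)) (∈-map⁺ (act s) x∈))

  adj-sym : ∀ {u v s} → Adj S u v s → Adj S v u s
  adj-sym (inj₁ p) = inj₂ p
  adj-sym (inj₂ p) = inj₁ p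

  signProduct : List Sign → Sign
  signProduct []       = pos
  signProduct (s ∷ ss) = s · signProduct ss

  walk-agree : ∀ {u v vs ss} → Walk S u v vs ss → Agree (signProduct ss) u v
  walk-agree here x x∈ = x∈
  walk-agree {u} {v} {ss = s ∷ ss} (step a w) x x∈ =
    subst (_∈ lookup L v) (trans (sym (act-· (signProduct ss) s x)) (cong (λ t → act t x) (·-comm (signProduct ss) s)))
      (walk-agree w (act s x) (adj-agree a x x∈))
    where
    ·-comm : ∀ s t → s · t ≡ t · s
    ·-comm pos pos = refl
    ·-comm pos neg = refl
    ·-comm neg pos = refl
    ·-comm neg neg = refl

  odd-product : ∀ ss → Odd (negCount ss) → signProduct ss ≡ neg
  even-product : ∀ ss → Even (negCount ss) → signProduct ss ≡ pos
  odd-product []         (t , ())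
  odd-product (pos ∷ ss) h = odd-product ss h
  odd-product (neg ∷ ss) (t , p) = cong (neg ·_) (even-product ss (t , suc-injective p))
  even-product []         _ = refl
  even-product (pos ∷ ss) h = even-product ss h
  even-product (neg ∷ ss) (suc t , p) = cong (neg ·_) (odd-product ss (t , trans (suc-injective p) (+-suc t (t + 0))))

  Symmetric : Fin (n S) → Set
  Symmetric v = ∀ x → x ∈ lookup L v → - x ∈ lookup L v

  -- Negation commutes with signs: go back along the edge, negate, and return.
  adj-symmetric : ∀ {u v s} → Adj S u v s → Symmetric u → Symmetric v
  adj-symmetric {u} {v} {s} a sym-u x x∈ = subst (_∈ lookup L v) (conj s x)
    (adj-agree a _ (sym-u (act s x) (adj-agree (adj-sym a) x x∈)))
    where
    conj : ∀ s x → act s (- act s x) ≡ - x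
    conj pos x = refl
    conj neg x = cong -_ (ℤ.neg-involutive x)

  walk-symmetric : ∀ {u v vs ss} → Walk S u v vs ss → Symmetric v → Symmetric u
  walk-symmetric here       h = h
  walk-symmetric (step a w) h = adj-symmetric (adj-sym a) (walk-symmetric w h)

  on-walk-symmetric : ∀ {u v vs ss x} → Walk S u v vs ss → Symmetric u → x ∈ vs → Symmetric x
  on-walk-symmetric here       h (here refl) = h
  on-walk-symmetric (step a w) h (here refl) = h
  on-walk-symmetric (step a w) h (there x∈)  = on-walk-symmetric w (adj-symmetric a h) x∈

  -- One turn around the cycle from its base vertex multiplies colours by the sign product, which is
  -- -1. The other vertices inherit the symmetry along the walk.
  cycle-symmetric : ∀ {vs} → UnbalancedCycle S vs → ∀ {w} → w ∈ vs → Symmetric w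
  cycle-symmetric (u , w , ss , s , walk , _ , _ , closing , odd) = on-walk-symmetric walk start
    where
    start : Symmetric u
    start x x∈ = subst (λ t → act t x ∈ lookup L u) (odd-product (s ∷ ss) odd)
      (subst (_∈ lookup L u) (sym (act-· s (signProduct ss) x))
        (adj-agree closing _ (walk-agree walk x x∈)))

  component-symmetric : ∀ v → InUnbalancedComponent S v → SetEq (lookup L v) (map -_ (lookup L v))
  component-symmetric v (vs , cycle , w , w∈ , _ , _ , walk) x =
    (λ x∈ → subst (_∈ map -_ (lookup L v)) (ℤ.neg-involutive x) (∈-map⁺ -_ (v-symmetric x x∈))) ,
    λ x∈ → back (∈-map⁻ -_ x∈)
    where
    v-symmetric : Symmetric v
    v-symmetric = walk-symmetric walk (cycle-symmetric cycle w∈)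
    back : ∃ (λ y → y ∈ lookup L v × x ≡ - y) → x ∈ lookup L v
    back (y , y∈ , refl) = v-symmetric y y∈

-- The minimum and the assignments attaining it

module Colorings (S : SignedGraph) (k : ℕ) (k>0 : 0 < k) (bound : KBound (numEdges S) k) (b : Bool) (M-zero : HasZero b (M k)) where

  MAssign : ListAssignment S
  MAssign = constAssign (n S) (M k)

  M-assignment : KAssignment S k MAssign
  M-assignment v rewrite lookup-constAssign (n S) (M k) v = M-unique k , M-length k

  M-HasZero : ∀ v → HasZero b (lookup MAssign v)
  M-HasZero v rewrite lookup-constAssign (n S) (M k) v = M-zero

  M-common : ∀ s u v → k ≤ length (common s (lookup MAssign u) (lookup MAssign v))
  M-common s u v rewrite lookup-constAssign (n S) (M k) u | lookup-constAssign (n S) (M k) v = ≤-reflexive (sym (common-M k s))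

  module _ (L : ListAssignment S) (L-size : KAssignment S k L) (L-zero : ∀ v → HasZero b (lookup L v)) where

    deficit : Edge (n S) → ℕ
    deficit (u , v , s) = k ∸ length (common s (lookup L u) (lookup L v))

    common≤k : ∀ u v s → length (common s (lookup L u) (lookup L v)) ≤ k
    common≤k u v s = ≤-trans (length-filter (λ z → act s z ∈? lookup L u) (lookup L v)) (≤-reflexive (proj₂ (L-size v)))

    open Comparison k b k>0 L MAssign L-size L-zero M-assignment M-HasZero M-common deficit
      (λ u v s → m+[n∸m]≡n (common≤k u v s))

    compared : count ρ₀ γ₀ (edges S) ≤ count ρ₀ β₀ (edges S) × (count ρ₀ β₀ (edges S) ≡ count ρ₀ γ₀ (edges S) → totalα (edges S) ≡ 0)
    compared = comparison (edges S) (loopless S) (simple S) (odd-part-< (numEdges S ∸ 1) k k>0 bound)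

    P≤PL : P S k ≤ PL S L
    P≤PL = subst₂ _≤_ (sym (PL-count S MAssign)) (sym (PL-count S L)) (proj₁ compared)

    totalα-0 : ∀ R → totalα R ≡ 0 → All (λ e → deficit e ≡ 0) R
    totalα-0 []      _ = []
    totalα-0 (e ∷ R) p = m+n≡0⇒m≡0 (deficit e) p ∷ totalα-0 R (m+n≡0⇒n≡0 (deficit e) p)

    extremal : PL S L ≡ P S k → EdgeCompatible S L
    extremal eq = All.map (λ {e} → edge {e}) (totalα-0 (edges S) (proj₂ compared
      (trans (sym (PL-count S L)) (trans eq (PL-count S MAssign)))))
      where
      edge : ∀ {e} → deficit e ≡ 0 → let (u , v , s) = e in SetEq (lookup L v) (scale s (lookup L u))
      edge {u , v , s} d = common-full s (proj₁ (L-size v)) (proj₂ (L-size u)) (proj₂ (L-size v))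
        (≤-antisym (common≤k u v s) (m∸n≡0⇒m≤n d))

    structure : PL S L ≡ P S k → EdgeCompatible S L ×
      (Unbalanced S → ∀ v → InUnbalancedComponent S v → SetEq (lookup L v) (map -_ (lookup L v)))
    structure eq = extremal eq , λ _ → Components.component-symmetric S L (extremal eq)

theorem1p2 : (S : SignedGraph) (k : ℕ) → 0 < k → KBound (numEdges S) k →
    (Even k →
    IsMinOver S (λ L → KAssignment S k L × ZeroFree S L) (P S k) ×
    (∀ L → KAssignment S k L → ZeroFree S L → PL S L ≡ P S k →
    EdgeCompatible S L ×
    (Unbalanced S → ∀ v → InUnbalancedComponent S v →
    SetEq (lookup L v) (map -_ (lookup L v))))) ×
    (Odd k →
    IsMinOver S (λ L → KAssignment S k L × ZeroIncluded S L) (P S k) ×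
    (∀ L → KAssignment S k L → ZeroIncluded S L → PL S L ≡ P S k →
    EdgeCompatible S L ×
    (Unbalanced S → ∀ v → InUnbalancedComponent S v →
    SetEq (lookup L v) (map -_ (lookup L v)))))
theorem1p2 S k k>0 bound = even , odd
  where
  even : Even k → _
  even (t , refl) = ((MAssign , (M-assignment , M-HasZero) , refl) , λ L (size , zf) → P≤PL L size zf) , structure
    where open Colorings S k k>0 bound false (M-even t)
  odd : Odd k → _
  odd (t , refl) = ((MAssign , (M-assignment , M-HasZero) , refl) , λ L (size , zi) → P≤PL L size zi) , structure
    where open Colorings S k k>0 bound true (M-odd t)
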